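{- Let $U$ and $V$ be two finite dimensional vector spaces over the field $\mathbb{F}$, let $L\leq\mathrm{Lin}(U,V)$ be a linear subspace given by a basis and let an $h\in L$ be also given. Suppose that $L$ is spanned by $h$ and certain (unknown) transformations of rank one. (1) Then there exists a deterministic polynomial time algorithm which decides if $h$ is an element of $L$ of maximum rank. If $h$ is of maximum rank, then a subspace $W$ of $U$ is constructed such that $\mathrm{rk}\,h=\dim U-(\dim W-\dim LW)$. (2) If $h$ is not of maximum rank then, given rank one transformations that together with $h$ span $L$, we can compute an element $h'\in L$ with $\mathrm{rk}\,h'>\mathrm{rk}\,h$ in deterministic polynomial time.
   Context: $\mathrm{Lin}(U,V)$ denotes the vector space of $\mathbb{F}$-linear maps from $U$ to $V$. For a subspace $W\le U$, $LW$ denotes the linear span of $\{bw: b\in L,\ w\in W\}$ in $V$. "Maximum rank" means that $\mathrm{rk}\,h\geq\mathrm{rk}\,b$ for every $b\in L$. Linear maps are represented by matrices with respect to given bases of $U$ and $V$; polynomial time means a number of operations in $\mathbb{F}$ polynomial in the size of the input (in $\dim U$, $\dim V$ and the number of given transformations). In part (1) the rank one transformations are not given to the algorithm. -}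

module Defs where

open import Algebra.Apartness.Bundles using (HeytingField; HeytingCommutativeRing)
open import Algebra.Bundles using (CommutativeRing)
import Algebra.Properties.CommutativeMonoid.Sum as Sum
open import Data.Container.Core using (Container; _▷_; ⟦_⟧; map)
open import Data.Empty using (⊥)
open import Data.Fin.Base using (Fin)
open import Data.Integer.Base as ℤ using (+_)
open import Data.Maybe.Base using (Maybe; nothing; just; maybe′)
open import Data.Nat.Base using (ℕ; suc; _≤_; _<_; _⊔_)
open import Data.Product.Base using (Σ-syntax; ∃-syntax; _×_; _,_; curry; proj₁)
open import Data.Unit.Base using (⊤)
open import Data.Vec.Functional using (Vector; _∷_)
import Level as L
open import Level using (0ℓ)
open import Relation.Binary.Definitions using (Decidable)
open import Relation.Binary.PropositionalEquality.Core using (_≡_)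
open import Relation.Nullary.Decidable.Core using (yes; no)
open import Relation.Nullary.Negation.Core using (¬_)
open import Relation.Unary using (Pred; _∈_; _≐_)

-- A field in the usual sense, with decidable equality.  Apartness in a Heyting
-- field is tight and x # y says exactly that x - y is invertible, so once _#_
-- is decidable it is the negation of _≈_, and every nonzero element is
-- invertible.
record DiscreteField c ℓ₁ ℓ₂ : Set (L.suc (c L.⊔ ℓ₁ L.⊔ ℓ₂)) where
  field
    heytingField : HeytingField c ℓ₁ ℓ₂
  open HeytingField heytingField public
  field
    _#?_ : Decidable _#_
  open HeytingCommutativeRing heytingCommutativeRing public
    using (commutativeRing)
  open CommutativeRing commutativeRing public
    using (+-commutativeMonoid)

-- Algorithms over an unspecified field are algebraic computation trees.  X is
-- the set of registers in scope; the programs are first-order data that do not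
-- mention the field, so the only access to field elements is through
-- arithmetic instructions and zero tests, and every one of these is charged.
-- (Producing the constants 0 and 1 is charged too.)

data Instruction (X : Set) : Set where
  zero′ one′   : Instruction X
  add mul      : X → X → Instruction X
  neg inv      : X → Instruction X

-- The container C describes the output format: an answer consists of a shape,
-- together with a register for each position of that shape.
data Program (C : Container 0ℓ 0ℓ) (X : Set) : Set where
  halt   : ⟦ C ⟧ X → Program C X
  -- the result is put in a fresh register, `nothing'; old registers are `just x'
  exec   : Instruction X → Program C (Maybe X) → Program C X
  ifZero : X → (then else : Program C X) → Program C X

-- Number of field operations and zero tests on the longest branch, hence an
-- upper bound for every run over every field.
time : ∀ {C X} → Program C X → ℕ
time (halt _)       = 0
time (exec _ p)     = suc (time p)
time (ifZero _ p q) = suc (time p ⊔ time q)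

MatrixOutput : ℕ → ℕ → Container 0ℓ 0ℓ
MatrixOutput m n = ⊤ ▷ λ _ → Fin m × Fin n

-- `nothing' is the answer "not of maximum rank"; `just d' comes with d vectors
-- of length n, a basis of the constructed subspace.
WitnessOutput : ℕ → Container 0ℓ 0ℓ
WitnessOutput n = Maybe ℕ ▷ maybe′ (λ d → Fin d × Fin n) ⊥

module Over {c ℓ₁ ℓ₂} (F : DiscreteField c ℓ₁ ℓ₂) where

  private module K = DiscreteField F
  open Sum K.+-commutativeMonoid using (sum)

  -- Totalised by 0⁻¹ = 0.  #⇒invertible yields an inverse of x - 0#.
  inverse : K.Carrier → K.Carrier
  inverse x with x K.#? K.0#
  ... | yes x#0 = proj₁ (K.#⇒invertible x#0)
  ... | no  _   = K.0#

  value : ∀ {X : Set} → (X → K.Carrier) → Instruction X → K.Carrier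
  value ρ zero′     = K.0#
  value ρ one′      = K.1#
  value ρ (add x y) = ρ x K.+ ρ y
  value ρ (mul x y) = ρ x K.* ρ y
  value ρ (neg x)   = K.- ρ x
  value ρ (inv x)   = inverse (ρ x)

  run : ∀ {C} {X : Set} → Program C X → (X → K.Carrier) → ⟦ C ⟧ K.Carrier
  run (halt out)     ρ = map ρ out
  run (exec i p)     ρ = run p (maybe′ ρ (value ρ i))
  run (ifZero x p q) ρ with ρ x K.#? K.0#
  ... | yes _ = run q ρ
  ... | no  _ = run p ρ

  -- The space F^I for an index set I: F^n is Space (Fin n), and Lin (F^n , F^m)
  -- is the space of matrices.
  Space : Set → Set c
  Space I = I → K.Carrier

  Matrix : ℕ → ℕ → Set c
  Matrix m n = Space (Fin m × Fin n)

  infix 4 _≋_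
  _≋_ : ∀ {I} → Space I → Space I → Set ℓ₁
  x ≋ y = ∀ i → x i K.≈ y i

  𝟎 : ∀ {I} → Space I
  𝟎 _ = K.0#

  lincomb : ∀ {I k} → Vector K.Carrier k → Vector (Space I) k → Space I
  lincomb a v i = sum (λ j → a j K.* v j i)

  infixr 20 _·_
  _·_ : ∀ {m n} → Matrix m n → Space (Fin n) → Space (Fin m)
  (b · x) i = sum (λ j → b (i , j) K.* x j)

  ⟨_⟩ : ∀ {I k} → Vector (Space I) k → Pred (Space I) (c L.⊔ ℓ₁)
  ⟨ v ⟩ x = ∃[ a ] x ≋ lincomb a v

  Span : ∀ {I p} → Pred (Space I) p → Pred (Space I) (c L.⊔ ℓ₁ L.⊔ p)
  Span {I} S x = ∃[ k ] Σ[ v ∈ Vector (Space I) k ] (∀ j → v j ∈ S) × x ∈ ⟨ v ⟩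

  LinearlyIndependent : ∀ {I k} → Vector (Space I) k → Set (c L.⊔ ℓ₁)
  LinearlyIndependent v = ∀ a → lincomb a v ≋ 𝟎 → ∀ j → a j K.≈ K.0#

  HasDim : ∀ {I p} → Pred (Space I) p → ℕ → Set (c L.⊔ ℓ₁ L.⊔ p)
  HasDim {I} S d =
    Σ[ v ∈ Vector (Space I) d ] LinearlyIndependent v × S ≐ ⟨ v ⟩

  Image : ∀ {m n} → Matrix m n → Pred (Space (Fin m)) (c L.⊔ ℓ₁)
  Image b y = ∃[ x ] y ≋ b · x

  HasRank : ∀ {m n} → Matrix m n → ℕ → Set (c L.⊔ ℓ₁)
  HasRank b r = HasDim (Image b) r

  infix 4 _rk≤_ _rk<_
  _rk≤_ _rk<_ : ∀ {m n} → Matrix m n → Matrix m n → Set (c L.⊔ ℓ₁)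
  b rk≤ b′ = ∃[ r ] ∃[ s ] HasRank b r × HasRank b′ s × r ≤ s
  b rk< b′ = ∃[ r ] ∃[ s ] HasRank b r × HasRank b′ s × r < s

  MaximumRank : ∀ {m n p} → Pred (Matrix m n) p → Matrix m n → Set (c L.⊔ ℓ₁ L.⊔ p)
  MaximumRank L h = h ∈ L × (∀ b → b ∈ L → b rk≤ h)

  -- The space LW, i.e. the span of all products (not just the set of them).
  infixr 20 _∙_
  _∙_ : ∀ {m n p q} → Pred (Matrix m n) p → Pred (Space (Fin n)) q →
        Pred (Space (Fin m)) (c L.⊔ ℓ₁ L.⊔ p L.⊔ q)
  L ∙ W = Span (λ y → ∃[ b ] ∃[ w ] b ∈ L × w ∈ W × y ≋ b · w)

  SpannedWithRankOnes : ∀ {m n p l} → Pred (Matrix m n) p → Matrix m n →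
                        Vector (Matrix m n) l → Set (c L.⊔ ℓ₁ L.⊔ p)
  SpannedWithRankOnes L h R = (∀ i → HasRank (R i) 1) × L ≐ ⟨ h ∷ R ⟩

  -- rk h = dim U - (dim W - dim LW), with U = F^n; the subtraction is in ℤ.
  RankFormula : ∀ {m n p q} → Pred (Matrix m n) p → Matrix m n →
                Pred (Space (Fin n)) q → Set (c L.⊔ ℓ₁ L.⊔ p L.⊔ q)
  RankFormula {n = n} L h W =
    ∃[ r ] ∃[ d ] ∃[ e ] HasRank h r × HasDim W d × HasDim (L ∙ W) e ×
      + r ≡ + n ℤ.- (+ d ℤ.- + e)

  CorrectWitness : ∀ {m n p} → Pred (Matrix m n) p → Matrix m n →
                   ⟦ WitnessOutput n ⟧ K.Carrier → Set (c L.⊔ ℓ₁ L.⊔ p)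
  CorrectWitness L h (nothing , _) = ¬ MaximumRank L h
  CorrectWitness L h (just d  , w) =
    MaximumRank L h × LinearlyIndependent (curry w) × RankFormula L h ⟨ curry w ⟩

{-# OPTIONS --safe #-}
-- Let g be a generalised inverse of h.  Draw an edge from j to k if R k g R j is
-- nonzero; let j be a start if R j does not vanish on the kernel of h, and a sink
-- if its range is not contained in that of h.  For a path without shortcuts from
-- a start to a sink, triangularity shows that the range of h + Σ R j, summed over
-- the path, contains the ranges of h and of all these R j, so its rank exceeds
-- that of h; no scalars have to be chosen, whatever the size of the field.
--
-- If there is no path, then the x killed by all R k with k out of reach form a
-- space which contains the kernel of h, which L maps into the range of h, and
-- which is closed under h⁻¹L.  Hence the Wong sequence, the least W with these
-- closure properties, satisfies LW = hW, and for all b in L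
--   rk b ≤ dim bW + dim U/W ≤ dim LW + dim U - dim W = rk h.
-- The sequence can be computed without knowing the R j, the graph only with them.
module Submission where

open import Defs
import Algebra.Properties.Ring as RingProperties
import Algebra.Properties.Semiring.Sum as SemiringSum
open import Algebra.Bundles using (CommutativeRing)
open import Data.Bool.Base using (Bool; true; false; _∨_)
open import Data.Bool.Properties using (∨-zeroʳ) renaming (_≟_ to _≟ᵇ_)
open import Data.Container.Core using (Container; ⟦_⟧; map; _▷_)
open import Data.Empty using (⊥; ⊥-elim)
open import Data.Fin.Base using (Fin; zero; suc; _↑ʳ_; punchIn; punchOut)
open import Data.Fin.Properties using (+↔⊎; *↔×; splitAt-↑ʳ; punchIn-punchOut) renaming (_≟_ to _≟ᶠ_)
open import Data.Integer.Base as ℤ using ()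
open import Data.Integer.Properties as ℤₚ using ()
open import Data.List.Base as List using (List; length; filter; allFin)
open import Data.List.Membership.Propositional using (find) renaming (_∈_ to _∈ˡ_)
open import Data.List.Membership.Propositional.Properties using (∈-filter⁺; ∈-allFin)
open import Data.List.Properties using (filter-notAll; length-tabulate)
open import Data.List.Relation.Unary.All as All using (All)
open import Data.List.Relation.Unary.Any as Any using ()
open import Data.Maybe.Base using (Maybe; nothing; just)
open import Data.Nat.Base as ℕ using (ℕ; zero; suc; z≤n; s≤s; NonZero; >-nonZero)
open import Data.Nat.Properties as ℕₚ using ()
open import Data.Product.Base using (Σ-syntax; ∃-syntax; _×_; _,_; uncurry; proj₁; proj₂)
open import Data.Product.Function.NonDependent.Propositional using (_×-↔_)
open import Data.Sum.Base using (_⊎_; inj₁; inj₂; [_,_])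
open import Data.Sum.Function.Propositional using (_⊎-↔_)
open import Data.Unit.Base using (⊤; tt)
open import Data.Vec.Functional as V using (Vector)
open import Function.Base using (_∘_; id)
open import Function.Bundles using (_↔_; Inverse)
open import Function.Construct.Composition using (_↔-∘_)
open import Function.Construct.Identity using (↔-id)
open import Level as L using (0ℓ)
open import Relation.Binary.PropositionalEquality
  using (_≡_; cong; cong₂; subst; module ≡-Reasoning) renaming (refl to ≡-refl; sym to ≡-sym; trans to ≡-trans)
open import Relation.Nullary.Decidable.Core using (yes; no; does; ¬?)
open import Relation.Nullary.Negation.Core using (¬_; contradiction)
open import Relation.Unary using (Pred; _∈_; _≐_; _⊆_)

-- A `Program` is a finite tree, fixed before the field and the matrices are known. Whatever steers
-- the computation (the rank of h, the dimension of W, the graph) must therefore be read off from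
-- the branch that has been reached, and continuations receive it as ordinary indices and Booleans.
-- The trees can become exponentially large, but `time` is only the length of a longest branch. The
-- generalised inverse is kept as vectors xᵢ and functionals φᵢ with φᵢ(h xⱼ) = δᵢⱼ, where the h xᵢ
-- span the range of h: g y = Σ φᵢ(y) xᵢ. Each elimination round adds one such pair without changing
-- the others. The R j occur in the correctness proof of the first algorithm as well, although its
-- program does not see them. If there is a path, the answer `nothing` is right, while `just` is
-- always backed by the closure properties of the computed W. If there is none, the space cut out by
-- the R k confines the sequence, so the range of h is never left and the answer is `just`.

-- Arithmetic expressions, branching machines and their running time.

module Machines where
  open import Data.Nat.Base using (_≤_; _+_; _*_)
  open import Data.Vec.Functional using (_∷_)

  data Expr (I : Set) : Set where
    var       : I → Expr I
    0ᴱ 1ᴱ     : Expr I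
    _+ᴱ_ _*ᴱ_ : Expr I → Expr I → Expr I
    -ᴱ_ invᴱ  : Expr I → Expr I

  infixl 6 _+ᴱ_ _-ᴱ_
  infixl 7 _*ᴱ_
  infix  8 -ᴱ_

  _-ᴱ_ : ∀ {I} → Expr I → Expr I → Expr I
  a -ᴱ b = a +ᴱ -ᴱ b

  -- Subexpressions are evaluated afresh wherever they occur, so this measures a tree and not a
  -- shared circuit. The bracketing follows the order in which `evaluate` issues the instructions.
  size : ∀ {I} → Expr I → ℕ
  size (var _)  = 0
  size 0ᴱ       = 1
  size 1ᴱ       = 1
  size (a +ᴱ b) = size a + (size b + 1)
  size (a *ᴱ b) = size a + (size b + 1)
  size (-ᴱ a)   = size a + 1
  size (invᴱ a) = size a + 1

  renameᴱ : ∀ {I J} → (I → J) → Expr I → Expr J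
  renameᴱ f (var i)  = var (f i)
  renameᴱ f 0ᴱ       = 0ᴱ
  renameᴱ f 1ᴱ       = 1ᴱ
  renameᴱ f (a +ᴱ b) = renameᴱ f a +ᴱ renameᴱ f b
  renameᴱ f (a *ᴱ b) = renameᴱ f a *ᴱ renameᴱ f b
  renameᴱ f (-ᴱ a)   = -ᴱ renameᴱ f a
  renameᴱ f (invᴱ a) = invᴱ (renameᴱ f a)

  -- Programs whose instructions evaluate expressions.  In contrast to Program,
  -- the registers in scope after a step are an arbitrary reindexing of the old
  -- and the new ones.
  data Machine (C : Container 0ℓ 0ℓ) (I : Set) : Set₁ where
    halt : ⟦ C ⟧ I → Machine C I
    step : ∀ {J N : Set} {k} → Fin k ↔ N → (N → Expr I) → (J → I ⊎ N) → Machine C J → Machine C I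
    test : Expr I → (then else : Machine C I) → Machine C I

  -- The continuation is told how the old registers embed into the new context.
  Cont : Container 0ℓ 0ℓ → Set → Set → Set₁
  Cont C X A = ∀ {Y : Set} → (X → Y) → (A → Y) → Program C Y

  evaluate : ∀ {C I} {X : Set} → Expr I → (I → X) → (∀ {Y : Set} → (X → Y) → Y → Program C Y) → Program C X
  evaluate (var i)  σ k = k id (σ i)
  evaluate 0ᴱ       σ k = exec zero′ (k just nothing)
  evaluate 1ᴱ       σ k = exec one′ (k just nothing)
  evaluate (a +ᴱ b) σ k = evaluate a σ λ τ x → evaluate b (τ ∘ σ) λ τ′ y →
                          exec (add (τ′ x) y) (k (just ∘ τ′ ∘ τ) nothing)
  evaluate (a *ᴱ b) σ k = evaluate a σ λ τ x → evaluate b (τ ∘ σ) λ τ′ y →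
                          exec (mul (τ′ x) y) (k (just ∘ τ′ ∘ τ) nothing)
  evaluate (-ᴱ a)   σ k = evaluate a σ λ τ x → exec (neg x) (k (just ∘ τ) nothing)
  evaluate (invᴱ a) σ k = evaluate a σ λ τ x → exec (inv x) (k (just ∘ τ) nothing)

  evaluateAll : ∀ {C I} {X : Set} n → (Fin n → Expr I) → (I → X) → Cont C X (Fin n) → Program C X
  evaluateAll zero    e σ k = k id λ ()
  evaluateAll (suc n) e σ k = evaluate (e zero) σ λ τ x → evaluateAll n (e ∘ suc) (τ ∘ σ) λ τ′ xs →
                              k (τ′ ∘ τ) (τ′ x ∷ xs)

  compile : ∀ {C I} {X : Set} → Machine C I → (I → X) → Program C X
  compile (halt (s , out))     σ = halt (s , σ ∘ out)
  compile (step {k = n} enum e π M) σ =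
    evaluateAll n (e ∘ Inverse.to enum) σ λ τ xs → compile M ([ τ ∘ σ , xs ∘ Inverse.from enum ] ∘ π)
  compile (test e M N)         σ = evaluate e σ λ τ x → ifZero x (compile M (τ ∘ σ)) (compile N (τ ∘ σ))

  -- The bound is uniform in the placement σ of the registers, since `compile` changes the placement
  -- at every step. Being a record, it lets `M` and `t` be inferred.
  record _within_ {C I} (M : Machine C I) (t : ℕ) : Set₁ where
    constructor bounded
    field bound : ∀ {X : Set} (σ : I → X) → time (compile M σ) ≤ t
  open _within_

  within-weaken : ∀ {C I t u} {M : Machine C I} → t ≤ u → M within t → M within u
  within-weaken t≤u M≤ = bounded λ σ → ℕₚ.≤-trans (bound M≤ σ) t≤u

  time-evaluate : ∀ {C I} {X : Set} (e : Expr I) (σ : I → X)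
    (k : ∀ {Y : Set} → (X → Y) → Y → Program C Y) {t} →
    (∀ {Y : Set} (τ : X → Y) y → time (k τ y) ≤ t) → time (evaluate e σ k) ≤ size e + t
  time-evaluate (var i)  σ k k≤ = k≤ id (σ i)
  time-evaluate 0ᴱ       σ k k≤ = s≤s (k≤ just nothing)
  time-evaluate 1ᴱ       σ k k≤ = s≤s (k≤ just nothing)
  time-evaluate (a +ᴱ b) σ k {t} k≤ =
    ℕₚ.≤-trans (time-evaluate a σ _ λ τ x → time-evaluate b (τ ∘ σ) _ λ τ′ y → s≤s (k≤ _ nothing))
              (ℕₚ.≤-reflexive (≡-trans (cong (size a +_) (≡-sym (ℕₚ.+-assoc (size b) 1 t))) (≡-sym (ℕₚ.+-assoc (size a) _ t))))
  time-evaluate (a *ᴱ b) σ k {t} k≤ =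
    ℕₚ.≤-trans (time-evaluate a σ _ λ τ x → time-evaluate b (τ ∘ σ) _ λ τ′ y → s≤s (k≤ _ nothing))
              (ℕₚ.≤-reflexive (≡-trans (cong (size a +_) (≡-sym (ℕₚ.+-assoc (size b) 1 t))) (≡-sym (ℕₚ.+-assoc (size a) _ t))))
  time-evaluate (-ᴱ a)   σ k {t} k≤ =
    ℕₚ.≤-trans (time-evaluate a σ _ λ τ x → s≤s (k≤ _ nothing)) (ℕₚ.≤-reflexive (≡-sym (ℕₚ.+-assoc (size a) 1 t)))
  time-evaluate (invᴱ a) σ k {t} k≤ =
    ℕₚ.≤-trans (time-evaluate a σ _ λ τ x → s≤s (k≤ _ nothing)) (ℕₚ.≤-reflexive (≡-sym (ℕₚ.+-assoc (size a) 1 t)))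

  time-evaluateAll : ∀ {C I} {X : Set} n (e : Fin n → Expr I) (σ : I → X) (k : Cont C X (Fin n)) {c t} →
    (∀ i → size (e i) ≤ c) → (∀ {Y : Set} (τ : X → Y) ys → time (k τ ys) ≤ t) →
    time (evaluateAll n e σ k) ≤ n * c + t
  time-evaluateAll zero    e σ k e≤ k≤ = k≤ id λ ()
  time-evaluateAll (suc n) e σ k {c} {t} e≤ k≤ =
    ℕₚ.≤-trans (time-evaluate (e zero) σ _ λ τ x → time-evaluateAll n (e ∘ suc) (τ ∘ σ) _ (e≤ ∘ suc) λ τ′ ys → k≤ _ _)
    (ℕₚ.≤-trans (ℕₚ.+-monoˡ-≤ _ (e≤ zero)) (ℕₚ.≤-reflexive (≡-sym (ℕₚ.+-assoc c (n * c) t))))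

  halt-within : ∀ {C I} (out : ⟦ C ⟧ I) {t} → halt {C} out within t
  halt-within out = bounded λ σ → z≤n

  step-within : ∀ {C I} {J N : Set} {k c t} {enum : Fin k ↔ N} {e : N → Expr I} {π : J → I ⊎ N} {M : Machine C J} →
    (∀ ν → size (e ν) ≤ c) → M within t → step enum e π M within (k * c + t)
  step-within {k = n} {enum = enum} e≤ M≤ = bounded λ σ →
    time-evaluateAll n _ σ _ (e≤ ∘ Inverse.to enum) λ τ xs → bound M≤ _

  test-within : ∀ {C I c t} {e : Expr I} {M N : Machine C I} →
    size e ≤ c → M within t → N within t → test e M N within (suc c + t)
  test-within {c = c} {t} {e} e≤ M≤ N≤ = bounded λ σ →
    ℕₚ.≤-trans (time-evaluate e σ _ {suc t} λ τ x → s≤s (ℕₚ.⊔-lub (bound M≤ _) (bound N≤ _)))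
    (ℕₚ.≤-trans (ℕₚ.+-monoˡ-≤ (suc t) e≤) (ℕₚ.≤-reflexive (ℕₚ.+-suc c t)))

  -- The `then` branch of `test` is the case zero, so the search goes on there and the first nonzero
  -- value ends it. Passing the index to `found` costs nothing: each index has its own branch of the
  -- tree.
  searchFin : ∀ {C I} n → (Fin n → Expr I) → (Fin n → Machine C I) → Machine C I → Machine C I
  searchFin zero    e found none = none
  searchFin (suc n) e found none = test (e zero) (searchFin n (e ∘ suc) (found ∘ suc) none) (found zero)

  search : ∀ {C I} {A : Set} {n} → Fin n ↔ A → (A → Expr I) → (A → Machine C I) → Machine C I → Machine C I
  search {n = n} enum e found none = searchFin n (e ∘ Inverse.to enum) (found ∘ Inverse.to enum) none

  searchFin-within : ∀ {C I c t} n {e : Fin n → Expr I} {found} {none : Machine C I} → (∀ i → size (e i) ≤ c) →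
    (∀ i → found i within t) → none within t → searchFin n e found none within (n * suc c + t)
  searchFin-within zero    e≤ found≤ none≤ = none≤
  searchFin-within {c = c} {t} (suc n) e≤ found≤ none≤ =
    within-weaken (ℕₚ.≤-reflexive (≡-sym (ℕₚ.+-assoc (suc c) (n * suc c) t)))
      (test-within (e≤ zero) (searchFin-within n (e≤ ∘ suc) (found≤ ∘ suc) none≤)
        (within-weaken (ℕₚ.m≤n+m t (n * suc c)) (found≤ zero)))

  search-within : ∀ {C I c t} {A : Set} {n} (enum : Fin n ↔ A) {e : A → Expr I} {found} {none : Machine C I} →
    (∀ a → size (e a) ≤ c) → (∀ a → found a within t) → none within t →
    search enum e found none within (n * suc c + t)
  search-within {n = n} enum e≤ found≤ none≤ = searchFin-within n (e≤ ∘ Inverse.to enum) (found≤ ∘ Inverse.to enum) none≤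

  -- The branch reached determines the table, so no register has to hold it. A copy of `cont` is
  -- made for every outcome, which enlarges the tree but adds to the depth only once.
  surveyFin : ∀ {C I} {B : Set} {k} n → Fin k ↔ B → (Fin n → B → Expr I) → ((Fin n → Bool) → Machine C I) → Machine C I
  surveyFin zero    enum e cont = cont λ ()
  surveyFin (suc n) enum e cont = search enum (e zero)
    (λ _ → surveyFin n enum (e ∘ suc) (cont ∘ (true ∷_)))
    (surveyFin n enum (e ∘ suc) (cont ∘ (false ∷_)))

  survey : ∀ {C I} {A B : Set} {n k} → Fin n ↔ A → Fin k ↔ B → (A → B → Expr I) → ((A → Bool) → Machine C I) → Machine C I
  survey {n = n} enumA enumB e cont = surveyFin n enumB (e ∘ Inverse.to enumA) λ t → cont (t ∘ Inverse.from enumA)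

  surveyFin-within : ∀ {C I c t} {B : Set} {k} n (enum : Fin k ↔ B) {e : Fin n → B → Expr I} {cont : _ → Machine C I} →
    (∀ i b → size (e i b) ≤ c) → (∀ t′ → cont t′ within t) → surveyFin n enum e cont within (n * (k * suc c) + t)
  surveyFin-within zero enum e≤ cont≤ = cont≤ _
  surveyFin-within {c = c} {t} {k = k} (suc n) enum {e} {cont} e≤ cont≤ =
    within-weaken (ℕₚ.≤-reflexive (≡-sym (ℕₚ.+-assoc (k * suc c) (n * (k * suc c)) t)))
      (search-within enum {e zero} (e≤ zero)
        (λ _ → surveyFin-within n enum {cont = cont ∘ (true ∷_)} (e≤ ∘ suc) (cont≤ ∘ (true ∷_)))
        (surveyFin-within n enum {cont = cont ∘ (false ∷_)} (e≤ ∘ suc) (cont≤ ∘ (false ∷_))))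

  survey-within : ∀ {C I c t} {A B : Set} {n k} (enumA : Fin n ↔ A) (enumB : Fin k ↔ B) {e : A → B → Expr I}
    {cont : _ → Machine C I} → (∀ a b → size (e a b) ≤ c) → (∀ t′ → cont t′ within t) →
    survey enumA enumB e cont within (n * (k * suc c) + t)
  survey-within {n = n} enumA enumB e≤ cont≤ = surveyFin-within n enumB (e≤ ∘ Inverse.to enumA) (λ t′ → cont≤ _)

  _×ᶠ_ : ∀ {A B : Set} {m n} → Fin m ↔ A → Fin n ↔ B → Fin (m * n) ↔ (A × B)
  _×ᶠ_ {m = m} {n} f g = (f ×-↔ g) ↔-∘ *↔×

  _⊎ᶠ_ : ∀ {A B : Set} {m n} → Fin m ↔ A → Fin n ↔ B → Fin (m + n) ↔ (A ⊎ B)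
  _⊎ᶠ_ {m = m} {n} f g = (f ⊎-↔ g) ↔-∘ +↔⊎

  fin : ∀ n → Fin n ↔ Fin n
  fin n = ↔-id (Fin n)

  infixr 20 _·ᴱ_

  sumᴱ : ∀ {I n} → (Fin n → Expr I) → Expr I
  sumᴱ {n = zero}  e = 0ᴱ
  sumᴱ {n = suc n} e = e zero +ᴱ sumᴱ (e ∘ suc)

  dotᴱ : ∀ {I n} → (Fin n → Expr I) → (Fin n → Expr I) → Expr I
  dotᴱ φ y = sumᴱ (λ q → φ q *ᴱ y q)

  _·ᴱ_ : ∀ {I m n} → (Fin m × Fin n → Expr I) → (Fin n → Expr I) → Fin m → Expr I
  (b ·ᴱ x) i = dotᴱ (λ j → b (i , j)) x

  δᴱ : ∀ {I n} → Fin n → Fin n → Expr I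
  δᴱ zero    zero    = 1ᴱ
  δᴱ zero    (suc j) = 0ᴱ
  δᴱ (suc i) zero    = 0ᴱ
  δᴱ (suc i) (suc j) = δᴱ i j

  pullᴱ : ∀ {I m n d} → (Fin d → Fin n → Expr I) → (Fin d → Fin m → Expr I) → (Fin m → Expr I) → Fin n → Expr I
  pullᴱ x φ y a = dotᴱ (λ i → dotᴱ (φ i) y) (λ i → x i a)

  residualᴱ : ∀ {I m n d} → (Fin m × Fin n → Expr I) → (Fin d → Fin n → Expr I) → (Fin d → Fin m → Expr I) →
              (Fin n → Expr I) → Fin n → Expr I
  residualᴱ T x φ v a = v a -ᴱ pullᴱ x φ (T ·ᴱ v) a

  dualᴱ : ∀ {I m n d} → (Fin m × Fin n → Expr I) → (Fin d → Fin n → Expr I) → (Fin d → Fin m → Expr I) →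
          Expr I → Fin m → Fin m → Expr I
  dualᴱ T x φ ι p q = ι *ᴱ (δᴱ p q -ᴱ dotᴱ (λ i → (T ·ᴱ x i) p) (λ i → φ i q))

  -- Registers holding vectors x₁ … x_d of length n and functionals φ₁ … φ_d of
  -- length m, next to those in B.
  System : Set → ℕ → ℕ → ℕ → Set
  System B n m d = B ⊎ (Fin d × (Fin n ⊎ Fin m))

  vectorᴱ : ∀ {B n m d} → Fin d → Fin n → Expr (System B n m d)
  vectorᴱ i a = var (inj₂ (i , inj₁ a))

  functionalᴱ : ∀ {B n m d} → Fin d → Fin m → Expr (System B n m d)
  functionalᴱ i q = var (inj₂ (i , inj₂ q))

  enlarge : ∀ {B n m d} → System B n m (suc d) → System B n m d ⊎ (Fin n ⊎ Fin m)
  enlarge (inj₁ b)            = inj₁ (inj₁ b)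
  enlarge (inj₂ (zero  , aq)) = inj₂ aq
  enlarge (inj₂ (suc i , aq)) = inj₁ (inj₂ (i , aq))

  module Saturation {C : Container 0ℓ 0ℓ} {B : Set} {n m : ℕ} (T : Fin m × Fin n → Expr B) {N : ℕ → ℕ} {Candidate : ℕ → Set}
    (enum : ∀ d → Fin (N d) ↔ Candidate d) (candidate : ∀ d → Candidate d → Fin n → Expr (System B n m d))
    (done : ∀ d → Machine C (System B n m d)) where

    T↑ : ∀ d → Fin m × Fin n → Expr (System B n m d)
    T↑ d = renameᴱ inj₁ ∘ T

    newVector : ∀ d → Candidate d → Fin n → Expr (System B n m d)
    newVector d c = residualᴱ (T↑ d) vectorᴱ functionalᴱ (candidate d c)

    newImage : ∀ d → Candidate d × Fin m → Expr (System B n m d)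
    newImage d (c , p) = (T↑ d ·ᴱ newVector d c) p

    -- The coordinate p, corrected so as to vanish on the images of x₁ ... x_d, and divided by the
    -- pivot so as to be 1 on the new image. The old functionals need no update: they vanish on the
    -- new image because `newVector` is a residual.
    newFunctional : ∀ d → Candidate d × Fin m → Fin m → Expr (System B n m d)
    newFunctional d (c , p) = dualᴱ (T↑ d) vectorᴱ functionalᴱ (invᴱ (newImage d (c , p))) p

    -- Gaussian elimination: as long as possible, a candidate whose image under T
    -- is not in the span of the images of x₁ … x_d is added to the system.  The
    -- fuel has to be larger than m, as the latter are independent.
    saturate : ℕ → ∀ d → Machine C (System B n m d)
    saturate zero       d = done d
    saturate (suc fuel) d = search (enum d ×ᶠ fin m) (newImage d)
      (λ cp → step (fin n ⊎ᶠ fin m) [ newVector d (proj₁ cp) , newFunctional d cp ] enlarge (saturate fuel (suc d)))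
      (done d)

    gauss : Machine C B
    -- No instruction is issued here; the registers in `B` are merely regarded as a system of size
    -- 0.
    gauss = step (fin 0) (λ ()) (λ { (inj₁ b) → inj₁ b ; (inj₂ (() , _)) }) (saturate (suc m) 0)

    -- The equation for d and the fuel keeps d at most m + 1, so that quantities depending on d have
    -- uniform bounds. A round costs at most `X`: a test for each candidate and coordinate, then n +
    -- m new registers.
    saturate-within : ∀ {M s t} fuel d → d + fuel ≡ suc m → (∀ d → d ≤ suc m → N d ≤ M) →
      (∀ d → d ≤ suc m → ∀ cp → size (newImage d cp) ≤ s) →
      (∀ d → d ≤ suc m → ∀ c a → size (newVector d c a) ≤ s) →
      (∀ d → d ≤ suc m → ∀ cp q → size (newFunctional d cp q) ≤ s) →
      (∀ d → d ≤ suc m → done d within t) →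
      saturate fuel d within (fuel * (M * m * suc s + (n + m) * s) + t)
    saturate-within zero d d≡ M≤ image≤ vector≤ functional≤ done≤ =
      done≤ d (ℕₚ.≤-reflexive (≡-trans (≡-sym (ℕₚ.+-identityʳ d)) d≡))
    saturate-within {M} {s} {t} (suc fuel) d d≡ M≤ image≤ vector≤ functional≤ done≤ =
      within-weaken (begin
        N d * m * suc s + ((n + m) * s + (fuel * X + t)) ≤⟨ ℕₚ.+-monoˡ-≤ _ (ℕₚ.*-monoˡ-≤ (suc s) (ℕₚ.*-monoˡ-≤ m (M≤ d d≤))) ⟩
        M * m * suc s + ((n + m) * s + (fuel * X + t))   ≡⟨ ℕₚ.+-assoc (M * m * suc s) _ _ ⟨
        X + (fuel * X + t)                               ≡⟨ ℕₚ.+-assoc X _ _ ⟨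
        suc fuel * X + t                                 ∎)
      (search-within (enum d ×ᶠ fin m) {newImage d} (image≤ d d≤)
        (λ cp → step-within {e = [ newVector d (proj₁ cp) , newFunctional d cp ]}
          (λ { (inj₁ a) → vector≤ d d≤ (proj₁ cp) a ; (inj₂ q) → functional≤ d d≤ cp q })
          (saturate-within fuel (suc d) (≡-trans (≡-sym (ℕₚ.+-suc d fuel)) d≡) M≤ image≤ vector≤ functional≤ done≤))
        (within-weaken (ℕₚ.≤-trans (ℕₚ.m≤n+m t _) (ℕₚ.m≤n+m _ ((n + m) * s))) (done≤ d d≤)))
      where
      open ℕₚ.≤-Reasoning
      X = M * m * suc s + (n + m) * s
      d≤ : d ≤ suc m
      d≤ = ℕₚ.≤-trans (ℕₚ.m≤m+n d (suc fuel)) (ℕₚ.≤-reflexive d≡)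

    gauss-within : ∀ {M s t} → (∀ d → d ≤ suc m → N d ≤ M) →
      (∀ d → d ≤ suc m → ∀ cp → size (newImage d cp) ≤ s) →
      (∀ d → d ≤ suc m → ∀ c a → size (newVector d c a) ≤ s) →
      (∀ d → d ≤ suc m → ∀ cp q → size (newFunctional d cp q) ≤ s) →
      (∀ d → d ≤ suc m → done d within t) →
      gauss within (suc m * (M * m * suc s + (n + m) * s) + t)
    gauss-within M≤ image≤ vector≤ functional≤ done≤ =
      step-within {c = 0} (λ ()) (saturate-within (suc m) 0 ≡-refl M≤ image≤ vector≤ functional≤ done≤)

open Machines

-- Paths without shortcuts and separating sets in a finite directed graph.

module Paths where
  open import Data.List.Base using ([]; _∷_)
  open import Data.List.Relation.Unary.All using ([]; _∷_)

  ∨-false : ∀ a b → a ∨ b ≡ false → a ≡ false × b ≡ false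
  ∨-false false b b≡ = ≡-refl , b≡

  module _ {l : ℕ} (edge : Fin l → Fin l → Bool) (sink : Fin l → Bool) where

    -- A path from start to sink without shortcuts.
    data InducedPath : (start : Fin l → Bool) → List (Fin l) → Set where
      stop : ∀ {start j} → start j ≡ true → sink j ≡ true → InducedPath start (j ∷ [])
      move : ∀ {start j q} → start j ≡ true → sink j ≡ false → All (λ k → start k ≡ false) q →
             InducedPath (edge j) q → InducedPath start (j ∷ q)

    -- Only starts and edge targets in `vs` are constrained, so that visited vertices may be dropped
    -- in the recursion. For `allFin l` this is a set closed under edges which contains all starts
    -- and no sink.
    Separates : List (Fin l) → (start S : Fin l → Bool) → Set
    Separates vs start S =
      (∀ {v} → v ∈ˡ vs → start v ≡ true → S v ≡ true) ×
      (∀ {u v} → v ∈ˡ vs → S u ≡ true → edge u v ≡ true → S v ≡ true) ×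
      (∀ {u} → S u ≡ true → sink u ≡ false)

    restart : ∀ {start start′ j q} → (∀ k → start′ k ≡ false → start k ≡ false) → start j ≡ true →
      InducedPath start′ (j ∷ q) → InducedPath start (j ∷ q)
    restart start⊆ sj (stop _ sink-j)       = stop sj sink-j
    restart start⊆ sj (move _ ¬sink-j ¬s p) = move sj ¬sink-j (All.map (start⊆ _) ¬s) p

    tail-avoids : ∀ {start j q} → InducedPath start (j ∷ q) → All (λ k → start k ≡ false) q
    tail-avoids (stop _ _)      = []
    tail-avoids (move _ _ ¬s _) = ¬s

    -- If the path already begins in `start`, then v is left out. Otherwise it begins at a successor
    -- of v, and its later vertices avoid both `start` and the successors of v, so that putting v in
    -- front creates no shortcut.
    prepend : ∀ {start q} v → start v ≡ true → sink v ≡ false → InducedPath (λ w → start w ∨ edge v w) q →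
      ∃[ q′ ] length q′ ℕ.≤ suc (length q) × InducedPath start q′
    prepend {start} {[]} v sv ¬sink-v ()
    prepend {start} {j ∷ q} v sv ¬sink-v p with start j in sj
    ... | true  = _ , ℕₚ.n≤1+n _ , restart (λ k → proj₁ ∘ ∨-false (start k) (edge v k)) sj p
    ... | false = _ , ℕₚ.≤-refl , move sv ¬sink-v (sj ∷ All.map (proj₁ ∘ ∨-false _ _) (tail-avoids p))
                        (restart (λ k → proj₂ ∘ ∨-false (start k) (edge v k)) (vj p) p)
      where
      vj : InducedPath (λ w → start w ∨ edge v w) (j ∷ q) → edge v j ≡ true
      vj (stop s _)     rewrite sj = s
      vj (move s _ _ _) rewrite sj = s

    -- Graph search: a start v that is not a sink is removed from `vs`, and its successors become
    -- starts. A path found afterwards is extended by `prepend`, a separating set by v itself. The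
    -- bound on the length later bounds the cost of adding up the matrices along the path.
    path⊎separation : ∀ fuel vs → length vs ℕ.≤ fuel → ∀ start →
      (∃[ q ] length q ℕ.≤ suc fuel × InducedPath start q) ⊎ (∃[ S ] Separates vs start S)
    path⊎separation fuel vs vs≤ start with Any.any? (λ v → start v ≟ᵇ true) vs
    ... | no none = inj₂ ((λ _ → false) , (λ v∈ sv → contradiction (Any.map (λ { ≡-refl → sv }) v∈) none) , (λ _ ()) , λ ())
    ... | yes some with find some
    ...   | v , v∈ , sv with sink v in sink-v
    ...     | true  = inj₁ (_ , ℕ.s≤s ℕ.z≤n , stop sv sink-v)
    path⊎separation zero    (_ ∷ _) () start | yes some | v , v∈ , sv | false
    path⊎separation zero    []      vs≤ start | yes () | v , v∈ , sv | false
    path⊎separation (suc fuel) vs vs≤ start | yes some | v , v∈ , sv | false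
      with path⊎separation fuel (filter (λ w → ¬? (w ≟ᶠ v)) vs)
             (ℕ.s≤s⁻¹ (ℕₚ.≤-trans (filter-notAll (λ w → ¬? (w ≟ᶠ v)) vs (Any.map (λ { ≡-refl w≢w → w≢w ≡-refl }) v∈)) vs≤))
             (λ w → start w ∨ edge v w)
    ... | inj₁ (q , q≤ , p) with prepend v sv sink-v p
    ...   | q′ , q′≤ , p′ = inj₁ (q′ , ℕₚ.≤-trans q′≤ (ℕ.s≤s q≤) , p′)
    path⊎separation (suc fuel) vs vs≤ start | yes some | v , v∈ , sv | false
        | inj₂ (S , start⊆S , S-closed , S-avoids) =
      inj₂ (S′ , (λ w∈ sw → reach w∈ λ w∈′ → start⊆S w∈′ (cong (_∨ edge v _) sw)) , closed , avoids)
      where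
      S′ : Fin l → Bool
      S′ w = does (w ≟ᶠ v) ∨ S w
      reach : ∀ {w} → w ∈ˡ vs → (w ∈ˡ filter (λ w → ¬? (w ≟ᶠ v)) vs → S w ≡ true) → S′ w ≡ true
      reach {w} w∈ H with w ≟ᶠ v
      ... | yes _  = ≡-refl
      ... | no w≢v = H (∈-filter⁺ _ w∈ w≢v)
      closed : ∀ {u w} → w ∈ˡ vs → S′ u ≡ true → edge u w ≡ true → S′ w ≡ true
      closed {u} {w} w∈ S′u uw with u ≟ᶠ v
      ... | yes ≡-refl = reach w∈ λ w∈′ → start⊆S w∈′ (≡-trans (cong (start w ∨_) uw) (∨-zeroʳ (start w)))
      ... | no _       = reach w∈ λ w∈′ → S-closed w∈′ S′u uw
      avoids : ∀ {u} → S′ u ≡ true → sink u ≡ false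
      avoids {u} S′u with u ≟ᶠ v
      ... | yes ≡-refl = sink-v
      ... | no _       = S-avoids S′u

open Paths

-- The two algorithms and their polynomial time bounds.

module Algorithms where
  open import Data.Nat.Base using (_≤_; _+_; _*_; _^_; _⊔_)
  open import Data.List.Base using ([]; _∷_)

  -- Block `zero` is h; then comes the basis of L, followed in the second algorithm by the rank one
  -- matrices.
  Input : ℕ → ℕ → ℕ → Set
  Input k m n = Fin (suc k) × Fin m × Fin n

  hᴱ : ∀ {k m n} → Fin m × Fin n → Expr (Input k m n)
  hᴱ ij = var (zero , ij)

  -- With the unit vectors as candidates, the images h xᵢ finally form a basis of the range of h,
  -- and `pullᴱ` applied to the system is a generalised inverse g of h.
  module Elimination {C k n m} (done : ∀ d → Machine C (System (Input k m n) n m d)) =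
    Saturation hᴱ (λ _ → fin n) (λ _ → δᴱ) done

  -- The Wong sequence.  In B there is a system computing a generalised inverse g
  -- of h.  The span of x₁ … x_d grows from the kernel of h by taking preimages of
  -- its images under the A j, to be compared with the range of h only at the end.
  module Wong {k n m d₁ : ℕ} where
    B : Set
    B = System (Input k m n) n m d₁

    𝐈ᴱ : Fin n × Fin n → Expr B
    𝐈ᴱ (i , j) = δᴱ i j

    module _ {d : ℕ} where
      h : Fin m × Fin n → Expr (System B n n d)
      h ij = var (inj₁ (inj₁ (zero , ij)))

      A : Fin k → Fin m × Fin n → Expr (System B n n d)
      A j ij = var (inj₁ (inj₁ (suc j , ij)))

      x : Fin d₁ → Fin n → Expr (System B n n d)
      x i a = var (inj₁ (inj₂ (i , inj₁ a)))

      φ : Fin d₁ → Fin m → Expr (System B n n d)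
      φ i q = var (inj₁ (inj₂ (i , inj₂ q)))

      product : Fin k → Fin d → Fin m → Expr (System B n n d)
      product j i = A j ·ᴱ vectorᴱ i

    Candidate : ℕ → Set
    Candidate d = Fin n ⊎ (Fin k × Fin d)

    -- The vectors (1 - gh) δ_c span the kernel of h. Modulo this kernel, g (A j xᵢ) is the only
    -- possible preimage of A j xᵢ under h.
    candidate : ∀ d → Candidate d → Fin n → Expr (System B n n d)
    candidate d (inj₁ c)       = residualᴱ h x φ (δᴱ c)
    candidate d (inj₂ (j , i)) = pullᴱ x φ (product j i)

    -- As hg is a projection onto the range of h, a vector y lies in that range exactly if y = hg y.
    escape : ∀ d → Fin k × Fin d × Fin m → Expr (System B n n d)
    escape d (j , i , p) = product j i p -ᴱ (h ·ᴱ pullᴱ x φ (product j i)) p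

    answer : ∀ d → Machine (WitnessOutput n) (System B n n d)
    answer d = search (fin k ×ᶠ (fin d ×ᶠ fin m)) (escape d)
      (λ _ → halt (nothing , ⊥-elim))
      (halt (just d , λ ia → inj₂ (proj₁ ia , inj₁ (proj₂ ia))))

    open Saturation 𝐈ᴱ (λ d → fin n ⊎ᶠ (fin k ×ᶠ fin d)) candidate answer public

  alg₁ : ∀ n m k → Program (WitnessOutput n) (Input k m n)
  alg₁ n m k = compile (Elimination.gauss λ d → Wong.gauss {k} {n} {m} {d}) id

  module Augment {k l n m d : ℕ} where
    I : Set
    I = System (Input (k + l) m n) n m d

    h : Fin m × Fin n → Expr I
    h ij = var (inj₁ (zero , ij))

    R : Fin l → Fin m × Fin n → Expr I
    R j ij = var (inj₁ (suc (k ↑ʳ j) , ij))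

    -- Since 1 - gh has the kernel of h as its range, and 1 - hg has the range of h as its kernel,
    -- the conditions on starts and sinks become the nonvanishing of R j (1 - gh) and (1 - hg) R j.
    startᴱ sinkᴱ : Fin l → Fin n × Fin m → Expr I
    startᴱ j (c , i) = (R j ·ᴱ residualᴱ h vectorᴱ functionalᴱ (δᴱ c)) i
    sinkᴱ j (c , i)  = (R j ·ᴱ δᴱ c) i -ᴱ (h ·ᴱ pullᴱ vectorᴱ functionalᴱ (R j ·ᴱ δᴱ c)) i

    edgeᴱ : Fin l × Fin l → Fin n × Fin m → Expr I
    edgeᴱ (j , j′) (c , i) = (R j′ ·ᴱ pullᴱ vectorᴱ functionalᴱ (R j ·ᴱ δᴱ c)) i

    augmentedᴱ : List (Fin l) → Fin m × Fin n → Expr I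
    augmentedᴱ []      ij = h ij
    augmentedᴱ (j ∷ q) ij = augmentedᴱ q ij +ᴱ R j ij

    output : List (Fin l) → Machine (MatrixOutput m n) I
    output q = step (fin m ×ᶠ fin n) (augmentedᴱ q) inj₂ (halt (tt , id))

    -- The search handles only Booleans, no field elements, and hence is carried out in the
    -- construction of the tree and not by instructions.
    paths : (start sink : Fin l → Bool) (edge : Fin l × Fin l → Bool) →
      (∃[ q ] length q ≤ suc l × InducedPath (λ j j′ → edge (j , j′)) sink start q) ⊎ _
    paths start sink edge = path⊎separation (λ j j′ → edge (j , j′)) sink l (allFin l) (ℕₚ.≤-reflexive (length-tabulate id)) start

    pathᴱ : (start sink : Fin l → Bool) (edge : Fin l × Fin l → Bool) → List (Fin l)
    -- The empty list is a default for the case of a separating set, which cannot occur if h is not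
    -- of maximum rank.
    pathᴱ start sink edge = [ proj₁ , (λ _ → []) ] (paths start sink edge)

    answer : Machine (MatrixOutput m n) I
    answer =
      survey (fin l) (fin n ×ᶠ fin m) startᴱ λ start →
      survey (fin l) (fin n ×ᶠ fin m) sinkᴱ λ sink →
      survey (fin l ×ᶠ fin l) (fin n ×ᶠ fin m) edgeᴱ λ edge →
      output (pathᴱ start sink edge)

  alg₂ : ∀ n m k l → Program (MatrixOutput m n) (Input (k + l) m n)
  alg₂ n m k l = compile (Elimination.gauss λ d → Augment.answer {k} {l} {n} {m} {d}) id

  -- Sums of three numbers below base ^ e are below base ^ suc e, so only
  -- exponents have to be tracked.
  module Bounds (base : ℕ) (3≤base : 3 ≤ base) where

    instance
      base-nonZero : NonZero base
      base-nonZero = >-nonZero (ℕₚ.≤-trans (s≤s z≤n) 3≤base)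

    infix 4 _≲_
    record _≲_ (x e : ℕ) : Set where
      constructor ≤^
      field bound : x ≤ base ^ e
    open _≲_ public

    below : ∀ {x y e} → x ≤ y → y ≲ e → x ≲ e
    below x≤y (≤^ y≤) = ≤^ (ℕₚ.≤-trans x≤y y≤)

    raise : ∀ {x e f} → e ≤ f → x ≲ e → x ≲ f
    raise e≤f (≤^ x≤) = ≤^ (ℕₚ.≤-trans x≤ (ℕₚ.^-monoʳ-≤ base e≤f))

    1≲ : ∀ e → 1 ≲ e
    1≲ e = raise {e = 0} z≤n (≤^ ℕₚ.≤-refl)

    0≲ : ∀ e → 0 ≲ e
    0≲ e = below z≤n (1≲ e)

    linear : ∀ {x} → x ≤ base → x ≲ 1
    linear x≤ = ≤^ (ℕₚ.≤-trans x≤ (ℕₚ.≤-reflexive (≡-sym (ℕₚ.*-identityʳ base))))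

    *≲ : ∀ {x y e f} → x ≲ e → y ≲ f → x * y ≲ e + f
    *≲ {e = e} {f} (≤^ x≤) (≤^ y≤) = ≤^ (ℕₚ.≤-trans (ℕₚ.*-mono-≤ x≤ y≤) (ℕₚ.≤-reflexive (≡-sym (ℕₚ.^-distribˡ-+-* base e f))))

    triple : ∀ {x y z e} → x ≲ e → y ≲ e → z ≲ e → x + (y + z) ≲ suc e
    triple {x} {y} {z} {e} (≤^ x≤) (≤^ y≤) (≤^ z≤) = ≤^ (begin
      x + (y + z)                             ≤⟨ ℕₚ.+-mono-≤ x≤ (ℕₚ.+-mono-≤ y≤ (ℕₚ.≤-trans z≤ (ℕₚ.m≤m+n _ 0))) ⟩
      3 * base ^ e                            ≤⟨ ℕₚ.*-monoˡ-≤ (base ^ e) 3≤base ⟩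
      base ^ suc e                            ∎)
      where open ℕₚ.≤-Reasoning

    +≲ : ∀ {x y e f} → x ≲ e → y ≲ f → x + y ≲ suc (e ⊔ f)
    +≲ {x} {y} {e} {f} x≲ y≲ = below (ℕₚ.+-monoʳ-≤ x (ℕₚ.m≤m+n y 0))
      (triple (raise (ℕₚ.m≤m⊔n e f) x≲) (raise (ℕₚ.m≤n⊔m e f) y≲) (0≲ _))

    suc≲ : ∀ {x e} → x ≲ e → suc x ≲ suc e
    suc≲ {x} {e} x≲ = below (ℕₚ.≤-reflexive (cong suc (≡-sym (ℕₚ.+-identityʳ x)))) (triple (1≲ e) x≲ (0≲ e))

    module _ {I : Set} where

      op≲ : ∀ {x y e} → x ≲ e → y ≲ e → x + (y + 1) ≲ suc e
      op≲ x≲ y≲ = triple x≲ y≲ (1≲ _)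

      -≲ : ∀ {a b : Expr I} {e} → size a ≲ e → size b ≲ e → size (a -ᴱ b) ≲ 2 + e
      -≲ {a} {b} {e} a≲ b≲ = op≲ (raise (ℕₚ.n≤1+n e) a≲) (below (ℕₚ.≤-reflexive (ℕₚ.+-comm (size b) 1)) (suc≲ b≲))

      size-sum : ∀ {n c} (e : Fin n → Expr I) → (∀ i → size (e i) ≤ c) → size (sumᴱ e) ≤ suc n * suc c
      size-sum {zero}  e e≤ = s≤s z≤n
      size-sum {suc n} {c} e e≤ = begin
        size (e zero) + (size (sumᴱ (e ∘ suc)) + 1) ≤⟨ ℕₚ.+-mono-≤ (e≤ zero) (ℕₚ.+-monoˡ-≤ 1 (size-sum (e ∘ suc) (e≤ ∘ suc))) ⟩
        c + (suc n * suc c + 1)                     ≡⟨ cong (c +_) (ℕₚ.+-comm _ 1) ⟩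
        c + suc (suc n * suc c)                     ≡⟨ ℕₚ.+-suc c _ ⟩
        suc (suc n) * suc c                         ∎
        where open ℕₚ.≤-Reasoning

      -- One power of the base pays for the number of summands, one for each product, and one for
      -- the addition that joins it to the rest.
      dot≲ : ∀ {n} {φ y : Fin n → Expr I} {e} → suc n ≤ base → (∀ q → size (φ q) ≲ e) → (∀ q → size (y q) ≲ e) →
        size (dotᴱ φ y) ≲ 3 + e
      dot≲ {φ = φ} {y} {e} n≤ φ≲ y≲ = below (size-sum (λ q → φ q *ᴱ y q) (λ q → bound (op≲ (φ≲ q) (y≲ q))))
        (*≲ (linear n≤) (suc≲ (≤^ ℕₚ.≤-refl)))

      ·≲ : ∀ {m n} {T : Fin m × Fin n → Expr I} {v : Fin n → Expr I} {e} → suc n ≤ base →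
        (∀ ij → size (T ij) ≲ e) → (∀ q → size (v q) ≲ e) → ∀ i → size ((T ·ᴱ v) i) ≲ 3 + e
      ·≲ {T = T} {v} n≤ T≲ v≲ i = dot≲ {φ = λ j → T (i , j)} {v} n≤ (λ j → T≲ (i , j)) v≲

      δ≲ : ∀ {n} e (i j : Fin n) → size (δᴱ {I} i j) ≲ e
      δ≲ e zero    zero    = 1≲ e
      δ≲ e zero    (suc j) = 1≲ e
      δ≲ e (suc i) zero    = 1≲ e
      δ≲ e (suc i) (suc j) = δ≲ e i j

      module _ {m n d} {x : Fin d → Fin n → Expr I} {φ : Fin d → Fin m → Expr I} (m≤ : suc m ≤ base) (n≤ : suc n ≤ base)
        (d≤ : suc d ≤ base) (x≲ : ∀ e i a → size (x i a) ≲ e) (φ≲ : ∀ e i q → size (φ i q) ≲ e) where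

        pull≲ : ∀ {y : Fin m → Expr I} {e} → (∀ q → size (y q) ≲ e) → ∀ a → size (pullᴱ x φ y a) ≲ 6 + e
        pull≲ {y} {e} y≲ a = dot≲ {φ = λ i → dotᴱ (φ i) y} {λ i → x i a} d≤ (λ i → dot≲ {φ = φ i} {y} m≤ (φ≲ _ i) y≲) (λ i → x≲ _ i a)

        module _ {T : Fin m × Fin n → Expr I} (T≲ : ∀ e ij → size (T ij) ≲ e) where

          residual≲ : ∀ {v : Fin n → Expr I} {e} → (∀ q → size (v q) ≲ e) → ∀ a → size (residualᴱ T x φ v a) ≲ 11 + e
          residual≲ {v} {e} v≲ a = -≲ {v a} {pullᴱ x φ (T ·ᴱ v) a} (raise (ℕₚ.m≤n+m e 9) (v≲ a))
            (pull≲ {T ·ᴱ v} (·≲ {T = T} {v} n≤ (T≲ _) v≲) a)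

          dual≲ : ∀ {ι e} → size ι ≲ 8 + e → ∀ p q → size (dualᴱ T x φ ι p q) ≲ 9 + e
          dual≲ {ι} {e} ι≲ p q = op≲ ι≲ (-≲ {δᴱ p q} {dotᴱ (λ i → (T ·ᴱ x i) p) (λ i → φ i q)} (δ≲ _ p q)
            (dot≲ {φ = λ i → (T ·ᴱ x i) p} {λ i → φ i q} d≤ (λ i → ·≲ {T = T} {x i} n≤ (T≲ _) (x≲ e i) p) (λ i → φ≲ _ i q)))

    size-rename : ∀ {I J} (f : I → J) e → size (renameᴱ f e) ≡ size e
    size-rename f (var i)  = ≡-refl
    size-rename f 0ᴱ       = ≡-refl
    size-rename f 1ᴱ       = ≡-refl
    size-rename f (a +ᴱ b) = cong₂ (λ x y → x + (y + 1)) (size-rename f a) (size-rename f b)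
    size-rename f (a *ᴱ b) = cong₂ (λ x y → x + (y + 1)) (size-rename f a) (size-rename f b)
    size-rename f (-ᴱ a)   = cong (_+ 1) (size-rename f a)
    size-rename f (invᴱ a) = cong (_+ 1) (size-rename f a)

    module _ {C B} {n m : ℕ} (T : Fin m × Fin n → Expr B) {N : ℕ → ℕ} {Candidate : ℕ → Set}
      (enum : ∀ d → Fin (N d) ↔ Candidate d) (candidate : ∀ d → Candidate d → Fin n → Expr (System B n m d))
      (done : ∀ d → Machine C (System B n m d))
      (m≤ : suc (suc m) ≤ base) (n≤ : suc n ≤ base) (n+m≤ : n + m ≤ base) (T≲ : ∀ e ij → size (T ij) ≲ e) where

      open Saturation T enum candidate done

      gauss≲ : ∀ {M μ e t τ} → (∀ d → d ≤ suc m → N d ≤ M) → M ≲ μ →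
        (∀ d → d ≤ suc m → ∀ c a → size (candidate d c a) ≲ e) →
        (∀ d → d ≤ suc m → done d within t) → t ≲ τ →
        Σ[ t′ ∈ ℕ ] gauss within t′ × t′ ≲ 1 + ((1 + (1 + ((μ + 1 + (17 + e)) ⊔ (1 + (16 + e))))) ⊔ τ)
      gauss≲ {M} {μ} {e} {t} {τ} N≤ M≲ candidate≲ done≤ t≲ =
        suc m * (M * m * suc s + (n + m) * s) + t ,
        gauss-within N≤
          (λ { d d≤ (c , p) → bound (raise {e = 14 + e} (ℕₚ.+-monoˡ-≤ e (ℕₚ.m≤n+m 14 2)) (image≲ d d≤ c p)) })
          (λ d d≤ c a → bound (raise {e = 11 + e} (ℕₚ.+-monoˡ-≤ e (ℕₚ.m≤n+m 11 5)) (vector≲ d d≤ c a)))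
          (λ { d d≤ (c , p) q → bound (functional≲ d d≤ c p q) })
          done≤ ,
        +≲ (*≲ (linear 1+m≤) (+≲
          (*≲ (*≲ M≲ (linear (ℕₚ.≤-trans (ℕₚ.n≤1+n m) 1+m≤))) (suc≲ (≤^ ℕₚ.≤-refl)))
          (*≲ (linear n+m≤) (≤^ ℕₚ.≤-refl)))) t≲
        where
        s : ℕ
        -- The largest of the three expressions decides: the exponents are 11 + e for vectors, 14 +
        -- e for images and 16 + e for functionals.
        s = base ^ (16 + e)
        1+m≤ : suc m ≤ base
        1+m≤ = ℕₚ.≤-trans (ℕₚ.n≤1+n _) m≤
        module _ (d : ℕ) (d≤ : d ≤ suc m) where
          1+d≤ : suc d ≤ base
          1+d≤ = ℕₚ.≤-trans (s≤s d≤) m≤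
          T↑≲ : ∀ e ij → size (T↑ d ij) ≲ e
          T↑≲ e ij = below (ℕₚ.≤-reflexive (size-rename inj₁ (T ij))) (T≲ e ij)
          vector≲ : ∀ c a → size (newVector d c a) ≲ 11 + e
          vector≲ c = residual≲ {x = vectorᴱ} {functionalᴱ} 1+m≤ n≤ 1+d≤ (λ e _ _ → 0≲ e) (λ e _ _ → 0≲ e)
            {T↑ d} T↑≲ {candidate d c} (candidate≲ d d≤ c)
          image≲ : ∀ c p → size (newImage d (c , p)) ≲ 14 + e
          image≲ c = ·≲ {T = T↑ d} {newVector d c} n≤ (T↑≲ _) (vector≲ c)
          functional≲ : ∀ c p q → size (newFunctional d (c , p) q) ≲ 16 + e
          functional≲ c p = dual≲ {x = vectorᴱ} {functionalᴱ} 1+m≤ n≤ 1+d≤ (λ e _ _ → 0≲ e) (λ e _ _ → 0≲ e) {T↑ d} T↑≲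
            {invᴱ (newImage d (c , p))} (below (ℕₚ.≤-reflexive (ℕₚ.+-comm _ 1)) (suc≲ (image≲ c p))) p

    module _ {n m k : ℕ} (m≤ : suc (suc m) ≤ base) (n≤ : suc (suc n) ≤ base) (n+m≤ : n + m ≤ base) (n+n≤ : n + n ≤ base)
      (k≤ : k ≤ base) where

      private
        1+n≤ : suc n ≤ base
        1+n≤ = ℕₚ.≤-trans (ℕₚ.n≤1+n _) n≤
        1+m≤ : suc m ≤ base
        1+m≤ = ℕₚ.≤-trans (ℕₚ.n≤1+n _) m≤
        n≤base : n ≤ base
        n≤base = ℕₚ.≤-trans (ℕₚ.n≤1+n _) 1+n≤
        m≤base : m ≤ base
        m≤base = ℕₚ.≤-trans (ℕₚ.n≤1+n _) 1+m≤

      elimination≲ : ∀ {C} {done : ∀ d → Machine C (System (Input k m n) n m d)} {t τ} →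
        (∀ d → d ≤ suc m → done d within t) → t ≲ τ →
        Σ[ t′ ∈ ℕ ] Elimination.gauss done within t′ × t′ ≲ 1 + (21 ⊔ τ)
      elimination≲ {done = done} = gauss≲ hᴱ (λ _ → fin n) (λ _ → δᴱ) done m≤ 1+n≤ n+m≤ (λ e _ → 0≲ e)
        {e = 0} (λ _ _ → ℕₚ.≤-refl) (linear n≤base) (λ _ _ → δ≲ 0)

      module _ {d₁ : ℕ} (d₁≤ : d₁ ≤ suc m) where
        open Wong {k} {n} {m} {d₁}

        g≲ : ∀ {d e} {y : Fin m → Expr (System B n n d)} → (∀ q → size (y q) ≲ e) → ∀ a → size (pullᴱ x φ y a) ≲ 6 + e
        g≲ {y = y} = pull≲ {x = x} {φ} 1+m≤ 1+n≤ (ℕₚ.≤-trans (s≤s d₁≤) m≤) (λ e _ _ → 0≲ e) (λ e _ _ → 0≲ e) {y}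

        product≲ : ∀ {d} j i p → size (product {d} j i p) ≲ 3
        product≲ j i = ·≲ {T = A j} {vectorᴱ i} 1+n≤ (λ _ → 0≲ 0) (λ _ → 0≲ 0)

        candidate≲ : ∀ d c a → size (candidate d c a) ≲ 11
        candidate≲ d (inj₁ c) = residual≲ {x = x} {φ} 1+m≤ 1+n≤ (ℕₚ.≤-trans (s≤s d₁≤) m≤) (λ e _ _ → 0≲ e) (λ e _ _ → 0≲ e)
          {h} (λ e _ → 0≲ e) {δᴱ c} (δ≲ 0 c)
        candidate≲ d (inj₂ (j , i)) a = raise (ℕₚ.m≤n+m 9 2) (g≲ {y = product j i} (product≲ j i) a)

        escape≲ : ∀ d c → size (escape d c) ≲ 14
        escape≲ d (j , i , p) = -≲ {a = product j i p} {b = (h ·ᴱ pullᴱ x φ (product j i)) p} (raise (ℕₚ.m≤n+m 3 9) (product≲ j i p))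
          (·≲ {T = h} {pullᴱ x φ (product j i)} 1+n≤ (λ _ → 0≲ 9) (g≲ {y = product j i} (product≲ j i)) p)

        wong≲ : Σ[ t ∈ ℕ ] gauss within t × t ≲ 35
        wong≲ = gauss≲ 𝐈ᴱ (λ d → fin n ⊎ᶠ (fin k ×ᶠ fin d)) candidate answer n≤ 1+n≤ n+n≤ (λ { e (i , j) → δ≲ e i j })
          {M = n + k * suc n} {3} {11}
          (λ d d≤ → ℕₚ.+-monoʳ-≤ n (ℕₚ.*-monoʳ-≤ k d≤))
          (+≲ (linear n≤base) (*≲ (linear k≤) (linear 1+n≤)))
          (λ d d≤ → candidate≲ d)
          (λ d d≤ → within-weaken (ℕₚ.+-monoˡ-≤ 0 (ℕₚ.*-monoˡ-≤ (suc (base ^ 14)) (ℕₚ.*-monoʳ-≤ k (ℕₚ.*-monoˡ-≤ m d≤))))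
            (search-within (fin k ×ᶠ (fin d ×ᶠ fin m)) {escape d} (λ c → bound (escape≲ d c))
              (λ _ → halt-within (nothing , ⊥-elim)) (halt-within _)))
          (+≲ (*≲ (*≲ (linear k≤) (*≲ (linear 1+n≤) (linear m≤base))) (suc≲ {e = 14} (≤^ ℕₚ.≤-refl))) (0≲ 0))

      alg₁≲ : time (alg₁ n m k) ≲ 36
      alg₁≲ =
        let t , within-t , t≲ = elimination≲ {done = λ d → Wong.gauss}
              (λ d d≤ → within-weaken (bound (proj₂ (proj₂ (wong≲ d≤)))) (proj₁ (proj₂ (wong≲ d≤)))) (≤^ ℕₚ.≤-refl)
        in below (_within_.bound within-t id) t≲

    module _ {k l n m : ℕ} (m≤ : suc (suc m) ≤ base) (n≤ : suc (suc n) ≤ base) (n+m≤ : n + m ≤ base) (l≤ : suc l ≤ base) where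

      private
        1+n≤ : suc n ≤ base
        1+n≤ = ℕₚ.≤-trans (ℕₚ.n≤1+n _) n≤
        1+m≤ : suc m ≤ base
        1+m≤ = ℕₚ.≤-trans (ℕₚ.n≤1+n _) m≤
        n≲ : n ≲ 1
        n≲ = linear (ℕₚ.≤-trans (ℕₚ.n≤1+n _) 1+n≤)
        m≲ : m ≲ 1
        m≲ = linear (ℕₚ.≤-trans (ℕₚ.n≤1+n _) 1+m≤)
        l≲ : l ≲ 1
        l≲ = linear (ℕₚ.≤-trans (ℕₚ.n≤1+n _) l≤)

      module _ {d : ℕ} (d≤ : d ≤ suc m) where
        open Augment {k} {l} {n} {m} {d}

        private
          1+d≤ : suc d ≤ base
          1+d≤ = ℕₚ.≤-trans (s≤s d≤) m≤

        gR≲ : ∀ j c a → size (pullᴱ vectorᴱ functionalᴱ (R j ·ᴱ δᴱ c) a) ≲ 9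
        gR≲ j c = pull≲ {x = vectorᴱ} {functionalᴱ} 1+m≤ 1+n≤ 1+d≤ (λ e _ _ → 0≲ e) (λ e _ _ → 0≲ e) {R j ·ᴱ δᴱ c} {3}
          (·≲ {T = R j} {δᴱ c} 1+n≤ (λ _ → 0≲ 0) (δ≲ 0 c))

        start≲ : ∀ j ci → size (startᴱ j ci) ≲ 14
        start≲ j (c , i) = ·≲ {T = R j} {residualᴱ h vectorᴱ functionalᴱ (δᴱ c)} 1+n≤ (λ _ → 0≲ 11)
          (residual≲ {x = vectorᴱ} {functionalᴱ} 1+m≤ 1+n≤ 1+d≤ (λ e _ _ → 0≲ e) (λ e _ _ → 0≲ e) {h} (λ e _ → 0≲ e) {δᴱ c} (δ≲ 0 c)) i

        sink≲ : ∀ j ci → size (sinkᴱ j ci) ≲ 14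
        sink≲ j (c , i) = -≲ {a = (R j ·ᴱ δᴱ c) i} {b = (h ·ᴱ pullᴱ vectorᴱ functionalᴱ (R j ·ᴱ δᴱ c)) i}
          (raise (ℕₚ.m≤n+m 3 9) (·≲ {T = R j} {δᴱ c} 1+n≤ (λ _ → 0≲ 0) (δ≲ 0 c) i))
          (·≲ {T = h} {pullᴱ vectorᴱ functionalᴱ (R j ·ᴱ δᴱ c)} 1+n≤ (λ _ → 0≲ 9) (gR≲ j c) i)

        edge≲ : ∀ jj′ ci → size (edgeᴱ jj′ ci) ≲ 14
        edge≲ (j , j′) (c , i) = raise (ℕₚ.m≤n+m 12 2)
          (·≲ {T = R j′} {pullᴱ vectorᴱ functionalᴱ (R j ·ᴱ δᴱ c)} 1+n≤ (λ _ → 0≲ 9) (gR≲ j c) i)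

        size-augmented : ∀ q ij → size (augmentedᴱ q ij) ≡ length q
        size-augmented []      ij = ≡-refl
        size-augmented (j ∷ q) ij = ≡-trans (ℕₚ.+-comm _ 1) (cong suc (size-augmented q ij))

        path≤ : ∀ start sink edge → length (pathᴱ start sink edge) ≤ base ^ 1
        path≤ start sink edge with paths start sink edge
        ... | inj₁ (q , q≤ , _) = ℕₚ.≤-trans q≤ (bound (linear l≤))
        ... | inj₂ _            = z≤n

        augment≲ : Σ[ t ∈ ℕ ] answer within t × t ≲ 22
        augment≲ = _ ,
          survey-within (fin l) (fin n ×ᶠ fin m) {startᴱ} (λ j ci → bound (start≲ j ci)) (λ start →
          survey-within (fin l) (fin n ×ᶠ fin m) {sinkᴱ} (λ j ci → bound (sink≲ j ci)) (λ sink →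
          survey-within (fin l ×ᶠ fin l) (fin n ×ᶠ fin m) {edgeᴱ} (λ jj′ ci → bound (edge≲ jj′ ci)) (λ edge →
          step-within {enum = fin m ×ᶠ fin n} {augmentedᴱ (pathᴱ start sink edge)} {inj₂}
            (λ ij → ℕₚ.≤-trans (ℕₚ.≤-reflexive (size-augmented (pathᴱ start sink edge) ij)) (path≤ start sink edge))
            (halt-within (tt , id) {0})))) ,
          +≲ (*≲ l≲ entries≲) (+≲ (*≲ l≲ entries≲) (+≲ (*≲ (*≲ l≲ l≲) entries≲)
            (+≲ (*≲ (*≲ m≲ n≲) (≤^ {e = 1} ℕₚ.≤-refl)) (0≲ 0))))
          where
          entries≲ : n * m * suc (base ^ 14) ≲ 17
          entries≲ = *≲ (*≲ n≲ m≲) (suc≲ {e = 14} (≤^ ℕₚ.≤-refl))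

      alg₂≲ : k + l ≤ base → n + n ≤ base → time (alg₂ n m k l) ≲ 23
      alg₂≲ k+l≤ n+n≤ =
        let t , within-t , t≲ = elimination≲ m≤ n≤ n+m≤ n+n≤ k+l≤ {done = λ d → Augment.answer {k}}
              (λ d d≤ → within-weaken (bound (proj₂ (proj₂ (augment≲ d≤)))) (proj₁ (proj₂ (augment≲ d≤)))) (≤^ ℕₚ.≤-refl)
        in below (_within_.bound within-t id) t≲

  ^-distribʳ-* : ∀ x y e → (x * y) ^ e ≡ x ^ e * y ^ e
  ^-distribʳ-* x y zero    = ≡-refl
  ^-distribʳ-* x y (suc e) = ≡-trans (cong (x * y *_) (^-distribʳ-* x y e)) (ℕₚ.[m*n]*[o*p]≡[m*o]*[n*p] x y (x ^ e) (y ^ e))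

  ≲⇒≤ : ∀ b {x} e → Bounds._≲_ (3 * suc b) (ℕₚ.m≤m*n 3 (suc b)) x e → x ≤ 3 ^ e * suc b ^ e
  ≲⇒≤ b e x≲ = ℕₚ.≤-trans (Bounds._≲_.bound x≲) (ℕₚ.≤-reflexive (^-distribʳ-* 3 (suc b) e))

  sum≤triple : ∀ {b x y} → x ≤ suc b → y ≤ suc b → x + y ≤ 3 * suc b
  sum≤triple x≤ y≤ = ℕₚ.+-mono-≤ x≤ (ℕₚ.≤-trans y≤ (ℕₚ.m≤m+n _ _))

  -- The exponent is 1 + 35: the 35 of `wong≲` exceeds the 21 of the surrounding elimination, and
  -- adding the two costs one more. The factor 3 makes the base at least 3 and leaves room for sums
  -- such as n + m.
  time-alg₁ : ∀ n m k → time (alg₁ n m k) ≤ 3 ^ 36 * suc (n + m + k) ^ 36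
  time-alg₁ n m k = ≲⇒≤ (n + m + k) 36 (alg₁≲
    (sum≤triple (s≤s z≤n) (s≤s m≤)) (sum≤triple (s≤s z≤n) (s≤s n≤))
    (sum≤triple (ℕₚ.m≤n⇒m≤1+n n≤) (ℕₚ.m≤n⇒m≤1+n m≤)) (sum≤triple (ℕₚ.m≤n⇒m≤1+n n≤) (ℕₚ.m≤n⇒m≤1+n n≤))
    (ℕₚ.≤-trans (ℕₚ.m≤n⇒m≤1+n (ℕₚ.m≤n+m k (n + m))) (ℕₚ.m≤m+n _ _)))
    where
    open Bounds (3 * suc (n + m + k)) (ℕₚ.m≤m*n 3 (suc (n + m + k)))
    n≤ : n ≤ n + m + k
    n≤ = ℕₚ.≤-trans (ℕₚ.m≤m+n n m) (ℕₚ.m≤m+n (n + m) k)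
    m≤ : m ≤ n + m + k
    m≤ = ℕₚ.≤-trans (ℕₚ.m≤n+m m n) (ℕₚ.m≤m+n (n + m) k)

  time-alg₂ : ∀ n m k l → time (alg₂ n m k l) ≤ 3 ^ 23 * suc (n + m + k + l) ^ 23
  time-alg₂ n m k l = ≲⇒≤ (n + m + k + l) 23 (alg₂≲
    (sum≤triple (s≤s z≤n) (s≤s m≤)) (sum≤triple (s≤s z≤n) (s≤s n≤))
    (sum≤triple (ℕₚ.m≤n⇒m≤1+n n≤) (ℕₚ.m≤n⇒m≤1+n m≤)) (sum≤triple (s≤s z≤n) (ℕₚ.m≤n⇒m≤1+n l≤))
    (sum≤triple (ℕₚ.m≤n⇒m≤1+n (ℕₚ.≤-trans (ℕₚ.m≤n+m k (n + m)) (ℕₚ.m≤m+n _ l))) (ℕₚ.m≤n⇒m≤1+n l≤))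
    (sum≤triple (ℕₚ.m≤n⇒m≤1+n n≤) (ℕₚ.m≤n⇒m≤1+n n≤)))
    where
    open Bounds (3 * suc (n + m + k + l)) (ℕₚ.m≤m*n 3 (suc (n + m + k + l)))
    l≤ : l ≤ n + m + k + l
    l≤ = ℕₚ.m≤n+m l (n + m + k)
    n≤ : n ≤ n + m + k + l
    n≤ = ℕₚ.≤-trans (ℕₚ.m≤m+n n m) (ℕₚ.≤-trans (ℕₚ.m≤m+n (n + m) k) (ℕₚ.m≤m+n _ l))
    m≤ : m ≤ n + m + k + l
    m≤ = ℕₚ.≤-trans (ℕₚ.m≤n+m m n) (ℕₚ.≤-trans (ℕₚ.m≤m+n (n + m) k) (ℕₚ.m≤m+n _ l))

open Algorithms

-- Running compiled machines over a field.

module Semantics {c ℓ₁ ℓ₂} (F : DiscreteField c ℓ₁ ℓ₂) where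
  open Over F
  open DiscreteField F using (_#_; _#?_; #⇒invertible; tight) public
  open CommutativeRing (DiscreteField.commutativeRing F) hiding (_≉_; zero) public

  zero⊎nonzero : ∀ x → x ≈ 0# ⊎ x # 0#
  zero⊎nonzero x with x #? 0#
  ... | yes x#0 = inj₂ x#0
  ... | no ¬x#0 = inj₁ (proj₁ (tight x 0#) ¬x#0)

  nonzero⇒≉ : ∀ {x} → x # 0# → ¬ x ≈ 0#
  nonzero⇒≉ x#0 x≈0 = proj₂ (tight _ _) x≈0 x#0

  inverseˡ : ∀ {x} → x # 0# → inverse x * x ≈ 1#
  inverseˡ {x} x#0 with x #? 0#
  ... | no ¬x#0 = contradiction x#0 ¬x#0
  ... | yes p with #⇒invertible p
  ...   | y , yx≈1 , _ = trans (*-congˡ (sym x-0≈x)) yx≈1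
    where
    x-0≈x : x - 0# ≈ x
    x-0≈x = trans (+-congˡ (trans (sym (+-identityˡ _)) (-‿inverseʳ 0#))) (+-identityʳ x)

  eval : ∀ {I} → Space I → Expr I → Carrier
  eval s (var i)  = s i
  eval s 0ᴱ       = 0#
  eval s 1ᴱ       = 1#
  eval s (a +ᴱ b) = eval s a + eval s b
  eval s (a *ᴱ b) = eval s a * eval s b
  eval s (-ᴱ a)   = - eval s a
  eval s (invᴱ a) = inverse (eval s a)

  eval-rename : ∀ {I J} (f : I → J) s e → eval s (renameᴱ f e) ≡ eval (s ∘ f) e
  eval-rename f s (var i)  = ≡-refl
  eval-rename f s 0ᴱ       = ≡-refl
  eval-rename f s 1ᴱ       = ≡-refl
  eval-rename f s (a +ᴱ b) = cong₂ _+_ (eval-rename f s a) (eval-rename f s b)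
  eval-rename f s (a *ᴱ b) = cong₂ _*_ (eval-rename f s a) (eval-rename f s b)
  eval-rename f s (-ᴱ a)   = cong -_ (eval-rename f s a)
  eval-rename f s (invᴱ a) = cong inverse (eval-rename f s a)

  module _ {C : Container 0ℓ 0ℓ} {q} (Q : ⟦ C ⟧ Carrier → Set q) where

    -- In `step`, the old registers agree as functions, but the new ones only pointwise. For a
    -- compiled program the former holds by computation, and the latter is what can be shown without
    -- function extensionality.
    data Ensures : ∀ {I} → Machine C I → Space I → Set (L.suc 0ℓ L.⊔ c L.⊔ ℓ₁ L.⊔ ℓ₂ L.⊔ q) where
      halt : ∀ {I} {s : Space I} {out} → Q (map s out) → Ensures (halt out) s
      step : ∀ {I J N k} {enum : Fin k ↔ N} {e : N → Expr I} {π : J → I ⊎ N} {M : Machine C J} {s} →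
             (∀ s′ → s′ ∘ inj₁ ≡ s → (∀ ν → s′ (inj₂ ν) ≡ eval s (e ν)) → Ensures M (s′ ∘ π)) →
             Ensures (step enum e π M) s
      test : ∀ {I} {e : Expr I} {M N s} → (eval s e ≈ 0# → Ensures M s) → (eval s e # 0# → Ensures N s) →
             Ensures (test e M N) s

    run-evaluate : ∀ {I} {X : Set} (e : Expr I) (σ : I → X) (k : ∀ {Y : Set} → (X → Y) → Y → Program C Y) ρ →
      (∀ {Y : Set} (τ : X → Y) y ρ′ → ρ′ ∘ τ ≡ ρ → ρ′ y ≡ eval (ρ ∘ σ) e → Q (run (k τ y) ρ′)) →
      Q (run (evaluate e σ k) ρ)
    run-evaluate (var i) σ k ρ H = H id (σ i) ρ ≡-refl ≡-refl
    run-evaluate 0ᴱ      σ k ρ H = H just nothing _ ≡-refl ≡-refl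
    run-evaluate 1ᴱ      σ k ρ H = H just nothing _ ≡-refl ≡-refl
    run-evaluate (a +ᴱ b) σ k ρ H =
      run-evaluate a σ _ ρ λ { τ x ρ₁ ≡-refl x≡ → run-evaluate b (τ ∘ σ) _ ρ₁ λ { τ′ y ρ₂ ≡-refl y≡ →
      H _ nothing _ ≡-refl (cong₂ _+_ x≡ y≡) } }
    run-evaluate (a *ᴱ b) σ k ρ H =
      run-evaluate a σ _ ρ λ { τ x ρ₁ ≡-refl x≡ → run-evaluate b (τ ∘ σ) _ ρ₁ λ { τ′ y ρ₂ ≡-refl y≡ →
      H _ nothing _ ≡-refl (cong₂ _*_ x≡ y≡) } }
    run-evaluate (-ᴱ a) σ k ρ H =
      run-evaluate a σ _ ρ λ { τ x ρ₁ ≡-refl x≡ → H _ nothing _ ≡-refl (cong -_ x≡) }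
    run-evaluate (invᴱ a) σ k ρ H =
      run-evaluate a σ _ ρ λ { τ x ρ₁ ≡-refl x≡ → H _ nothing _ ≡-refl (cong inverse x≡) }

    run-evaluateAll : ∀ {I} {X : Set} n (e : Fin n → Expr I) (σ : I → X) (k : Cont C X (Fin n)) ρ →
      (∀ {Y : Set} (τ : X → Y) ys ρ′ → ρ′ ∘ τ ≡ ρ → (∀ i → ρ′ (ys i) ≡ eval (ρ ∘ σ) (e i)) → Q (run (k τ ys) ρ′)) →
      Q (run (evaluateAll n e σ k) ρ)
    run-evaluateAll zero    e σ k ρ H = H id _ ρ ≡-refl λ ()
    run-evaluateAll (suc n) e σ k ρ H =
      run-evaluate (e zero) σ _ ρ λ { τ x ρ₁ ≡-refl x≡ →
      run-evaluateAll n (e ∘ suc) (τ ∘ σ) _ ρ₁ λ { τ′ xs ρ₂ ≡-refl xs≡ →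
      H _ _ ρ₂ ≡-refl λ { zero → x≡ ; (suc i) → xs≡ i } } }

    -- The placement σ enters only through the state ρ ∘ σ which the machine sees, so everything
    -- below may speak of machines and forget the registers of the program.
    run-compile : ∀ {I} {X : Set} {M : Machine C I} (σ : I → X) ρ → Ensures M (ρ ∘ σ) → Q (run (compile M σ) ρ)
    run-compile {M = halt _} σ ρ (halt H) = H
    run-compile {M = step enum e π M} σ ρ (step H) =
      run-evaluateAll _ (e ∘ Inverse.to enum) σ _ ρ λ { τ xs ρ₁ ≡-refl xs≡ →
      run-compile _ ρ₁ (H (ρ₁ ∘ [ τ ∘ σ , xs ∘ Inverse.from enum ]) ≡-refl λ ν →
        ≡-trans (xs≡ (Inverse.from enum ν)) (cong (eval (ρ ∘ σ) ∘ e) (Inverse.strictlyInverseˡ enum ν))) }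
    run-compile {M = test e M N} σ ρ (test H₀ H₁) =
      run-evaluate e σ _ ρ λ { τ x ρ₁ ≡-refl x≡ → branch τ x ρ₁ x≡ H₀ H₁ }
      where
      branch : ∀ {Y : Set} (τ : _ → Y) x ρ₁ → ρ₁ x ≡ eval (ρ₁ ∘ τ ∘ σ) e →
        (eval (ρ₁ ∘ τ ∘ σ) e ≈ 0# → Ensures M (ρ₁ ∘ τ ∘ σ)) → (eval (ρ₁ ∘ τ ∘ σ) e # 0# → Ensures N (ρ₁ ∘ τ ∘ σ)) →
        Q (run (ifZero x (compile M (τ ∘ σ)) (compile N (τ ∘ σ))) ρ₁)
      branch τ x ρ₁ x≡ H₀ H₁ with ρ₁ x #? 0#
      ... | yes x#0 = run-compile (τ ∘ σ) ρ₁ (H₁ (subst (_# 0#) x≡ x#0))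
      ... | no ¬x#0 = run-compile (τ ∘ σ) ρ₁ (H₀ (trans (reflexive (≡-sym x≡)) (proj₁ (tight _ _) ¬x#0)))

    ensures-searchFin : ∀ {I} n {e : Fin n → Expr I} {found none s} →
      (∀ i → eval s (e i) # 0# → Ensures (found i) s) → ((∀ i → eval s (e i) ≈ 0#) → Ensures none s) →
      Ensures (searchFin n e found none) s
    ensures-searchFin zero    Hfound Hnone = Hnone λ ()
    ensures-searchFin (suc n) Hfound Hnone = test
      (λ e≈0 → ensures-searchFin n (Hfound ∘ suc) λ es≈0 → Hnone λ { zero → e≈0 ; (suc i) → es≈0 i })
      (Hfound zero)

    ensures-search : ∀ {I A n} (enum : Fin n ↔ A) {e : A → Expr I} {found none s} →
      (∀ a → eval s (e a) # 0# → Ensures (found a) s) → ((∀ a → eval s (e a) ≈ 0#) → Ensures none s) →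
      Ensures (search enum e found none) s
    ensures-search {n = n} enum {e} {s = s} Hfound Hnone = ensures-searchFin n (Hfound ∘ Inverse.to enum) λ es≈0 →
      Hnone λ a → subst (λ a → eval s (e a) ≈ 0#) (Inverse.strictlyInverseˡ enum a) (es≈0 (Inverse.from enum a))

  -- The lifts only bring both cases to the same universe level.
  Detects : ∀ {B : Set} → Space B → Bool → Set (ℓ₁ L.⊔ ℓ₂)
  Detects v true  = L.Lift ℓ₁ (∃[ b ] v b # 0#)
  Detects v false = L.Lift ℓ₂ (v ≋ 𝟎)

  module _ {C : Container 0ℓ 0ℓ} {q} (Q : ⟦ C ⟧ Carrier → Set q) where

    ensures-surveyFin : ∀ {I B k} n (enum : Fin k ↔ B) {e : Fin n → B → Expr I} {cont s} →
      (∀ t → (∀ i → Detects (eval s ∘ e i) (t i)) → Ensures Q (cont t) s) → Ensures Q (surveyFin n enum e cont) s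
    ensures-surveyFin zero    enum H = H _ λ ()
    ensures-surveyFin (suc n) enum {e} H = ensures-search Q enum {e zero}
      (λ b eb#0 → ensures-surveyFin n enum {e ∘ suc} λ t D → H _ λ { zero → L.lift (b , eb#0) ; (suc i) → D i })
      (λ e≈0 → ensures-surveyFin n enum {e ∘ suc} λ t D → H _ λ { zero → L.lift e≈0 ; (suc i) → D i })

    ensures-survey : ∀ {I A B n k} (enumA : Fin n ↔ A) (enumB : Fin k ↔ B) {e : A → B → Expr I} {cont s} →
      (∀ t → (∀ a → Detects (eval s ∘ e a) (t a)) → Ensures Q (cont t) s) → Ensures Q (survey enumA enumB e cont) s
    ensures-survey {n = n} enumA enumB {e} {s = s} H = ensures-surveyFin n enumB λ t D → H _ λ a →
      subst (λ a′ → Detects (eval s ∘ e a′) (t (Inverse.from enumA a))) (Inverse.strictlyInverseˡ enumA a)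
            (D (Inverse.from enumA a))

-- Linear maps, subspaces and independence.

module LinearAlgebra {c ℓ₁ ℓ₂} (F : DiscreteField c ℓ₁ ℓ₂) where
  open import Data.Vec.Functional using (_∷_)
  open Over F public
  open Semantics F public
  open SemiringSum semiring using (sum; sum-cong-≋; ∑-distrib-+; ∑-comm; *-distribˡ-sum; sum-replicate-zero)
  open RingProperties ring using (-1*x≈-x; -‿distribˡ-*; -0#≈0#; x≈y⇒x∙y⁻¹≈ε; x[y-z]≈xy-xz)
  open import Relation.Binary.Reasoning.Setoid setoid

  x*0≈0 : ∀ {x y} → y ≈ 0# → x * y ≈ 0#
  x*0≈0 y≈0 = trans (*-congˡ y≈0) (zeroʳ _)

  x-0≈x : ∀ {x y} → y ≈ 0# → x - y ≈ x
  x-0≈x y≈0 = trans (+-congˡ (trans (-‿cong y≈0) -0#≈0#)) (+-identityʳ _)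

  1≉0 : ¬ 1# ≈ 0#
  1≉0 1≈0 = proj₂ (tight 1# 0#) 1≈0 (DiscreteField.invertible⇒# F
    (1# , trans (*-identityˡ _) (x-0≈x refl) , trans (*-identityʳ _) (x-0≈x refl)))

  zero⊎nonzeroEntry : ∀ {n} (x : Space (Fin n)) → x ≋ 𝟎 ⊎ (∃[ i ] x i # 0#)
  zero⊎nonzeroEntry {zero} x = inj₁ λ ()
  zero⊎nonzeroEntry {suc n} x with zero⊎nonzero (x zero) | zero⊎nonzeroEntry (x ∘ suc)
  ... | inj₂ x#0 | _              = inj₂ (zero , x#0)
  ... | inj₁ _   | inj₂ (i , x#0) = inj₂ (suc i , x#0)
  ... | inj₁ x≈0 | inj₁ xs≈0      = inj₁ λ { zero → x≈0 ; (suc i) → xs≈0 i }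

  infixl 6 _⊕_ _⊖_
  infixr 7 _⊙_

  _⊕_ _⊖_ : ∀ {I : Set} → Space I → Space I → Space I
  (x ⊕ y) i = x i + y i
  (x ⊖ y) i = x i - y i

  _⊙_ : ∀ {I : Set} → Carrier → Space I → Space I
  (a ⊙ x) i = a * x i

  δ : ∀ {n} → Vector (Space (Fin n)) n
  δ zero    zero    = 1#
  δ zero    (suc j) = 0#
  δ (suc i) zero    = 0#
  δ (suc i) (suc j) = δ i j

  δ-sym : ∀ {n} (i j : Fin n) → δ i j ≈ δ j i
  δ-sym zero    zero    = refl
  δ-sym zero    (suc j) = refl
  δ-sym (suc i) zero    = refl
  δ-sym (suc i) (suc j) = δ-sym i j

  dot : ∀ {n} → Space (Fin n) → Space (Fin n) → Carrier
  dot φ y = sum (λ q → φ q * y q)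

  dot-cong : ∀ {n} {φ φ′ y y′ : Space (Fin n)} → φ ≋ φ′ → y ≋ y′ → dot φ y ≈ dot φ′ y′
  dot-cong {n} φ≋ y≋ = sum-cong-≋ {n} λ q → *-cong (φ≋ q) (y≋ q)

  dot-congʳ : ∀ {n} (φ : Space (Fin n)) {y y′} → y ≋ y′ → dot φ y ≈ dot φ y′
  dot-congʳ φ = dot-cong {φ = φ} λ _ → refl

  dot-comm : ∀ {n} (φ y : Space (Fin n)) → dot φ y ≈ dot y φ
  dot-comm {n} φ y = sum-cong-≋ {n} λ q → *-comm (φ q) (y q)

  dot-𝟎 : ∀ {n} (φ : Space (Fin n)) {y} → y ≋ 𝟎 → dot φ y ≈ 0#
  dot-𝟎 {n} φ y≋𝟎 = trans (sum-cong-≋ {n} λ q → x*0≈0 (y≋𝟎 q)) (sum-replicate-zero n)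

  dot-𝟎ˡ : ∀ {n} (y : Space (Fin n)) → dot 𝟎 y ≈ 0#
  dot-𝟎ˡ y = trans (dot-comm 𝟎 y) (dot-𝟎 y λ _ → refl)

  dot-⊕ : ∀ {n} (φ x y : Space (Fin n)) → dot φ (x ⊕ y) ≈ dot φ x + dot φ y
  dot-⊕ {n} φ x y = trans (sum-cong-≋ {n} λ q → distribˡ (φ q) (x q) (y q)) (∑-distrib-+ (λ q → φ q * x q) (λ q → φ q * y q))

  dot-⊙ : ∀ {n} (φ : Space (Fin n)) a x → dot φ (a ⊙ x) ≈ a * dot φ x
  dot-⊙ {n} φ a x = begin
    sum (λ q → φ q * (a * x q)) ≈⟨ sum-cong-≋ {n} (λ q → trans (sym (*-assoc _ _ _)) (trans (*-congʳ (*-comm _ _)) (*-assoc _ _ _))) ⟩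
    sum (λ q → a * (φ q * x q)) ≈⟨ *-distribˡ-sum {n} a _ ⟨
    a * dot φ x ∎

  dot-⊕ˡ : ∀ {n} (φ ψ y : Space (Fin n)) → dot (φ ⊕ ψ) y ≈ dot φ y + dot ψ y
  dot-⊕ˡ φ ψ y = trans (dot-comm (φ ⊕ ψ) y) (trans (dot-⊕ y φ ψ) (+-cong (dot-comm y φ) (dot-comm y ψ)))

  dot-⊙ˡ : ∀ {n} a (φ y : Space (Fin n)) → dot (a ⊙ φ) y ≈ a * dot φ y
  dot-⊙ˡ a φ y = trans (dot-comm (a ⊙ φ) y) (trans (dot-⊙ y a φ) (*-congˡ (dot-comm y φ)))

  dot-lincomb : ∀ {n k} (φ : Space (Fin n)) a (v : Vector (Space (Fin n)) k) →
    dot φ (lincomb a v) ≈ dot a (λ j → dot φ (v j))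
  dot-lincomb {n} {k} φ a v = begin
    sum (λ q → φ q * sum (λ j → a j * v j q))   ≈⟨ sum-cong-≋ {n} (λ q → *-distribˡ-sum {k} (φ q) _) ⟩
    sum (λ q → sum (λ j → φ q * (a j * v j q))) ≈⟨ ∑-comm (λ q j → φ q * (a j * v j q)) ⟩
    sum (λ j → dot φ (a j ⊙ v j))               ≈⟨ sum-cong-≋ {k} (λ j → dot-⊙ φ (a j) (v j)) ⟩
    dot a (λ j → dot φ (v j))                   ∎

  dot-lincombˡ : ∀ {n k} a (v : Vector (Space (Fin n)) k) y →
    dot (lincomb a v) y ≈ dot a (λ j → dot (v j) y)
  dot-lincombˡ a v y = begin
    dot (lincomb a v) y       ≈⟨ dot-comm (lincomb a v) y ⟩
    dot y (lincomb a v)       ≈⟨ dot-lincomb y a v ⟩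
    dot a (λ j → dot y (v j)) ≈⟨ dot-congʳ a (λ j → dot-comm y (v j)) ⟩
    dot a (λ j → dot (v j) y) ∎

  dot-δ : ∀ {n} i (x : Space (Fin n)) → dot (δ i) x ≈ x i
  dot-δ zero    x = trans (+-cong (*-identityˡ _) (dot-𝟎ˡ (x ∘ suc))) (+-identityʳ _)
  dot-δ (suc i) x = trans (+-cong (zeroˡ _) (dot-δ i (x ∘ suc))) (+-identityˡ _)

  ⊖-as-⊕ : ∀ {I : Set} (x y : Space I) → x ⊖ y ≋ x ⊕ (- 1#) ⊙ y
  ⊖-as-⊕ x y i = +-congˡ (sym (-1*x≈-x (y i)))

  dot-⊖ : ∀ {n} (φ x y : Space (Fin n)) → dot φ (x ⊖ y) ≈ dot φ x - dot φ y
  dot-⊖ φ x y = begin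
    dot φ (x ⊖ y)                    ≈⟨ dot-congʳ φ (⊖-as-⊕ x y) ⟩
    dot φ (x ⊕ (- 1#) ⊙ y)           ≈⟨ dot-⊕ φ x _ ⟩
    dot φ x + dot φ ((- 1#) ⊙ y)     ≈⟨ +-congˡ (trans (dot-⊙ φ _ y) (-1*x≈-x _)) ⟩
    dot φ x - dot φ y                ∎

  lincomb-δ : ∀ {n} (x : Space (Fin n)) → x ≋ lincomb x δ
  lincomb-δ x i = begin
    x i                    ≈⟨ dot-δ i x ⟨
    dot (δ i) x            ≈⟨ dot-comm (δ i) x ⟩
    dot x (δ i)            ≈⟨ dot-congʳ x (δ-sym i) ⟩
    dot x (λ j → δ j i)    ∎

  record Linear {I J : Set} (f : Space I → Space J) : Set (c L.⊔ ℓ₁) where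
    field
      ≋-cong : ∀ {x y} → x ≋ y → f x ≋ f y
      ⊕-homo : ∀ x y → f (x ⊕ y) ≋ f x ⊕ f y
      ⊙-homo : ∀ a x → f (a ⊙ x) ≋ a ⊙ f x

    𝟎-homo : ∀ {x} → x ≋ 𝟎 → f x ≋ 𝟎
    𝟎-homo {x} x≋𝟎 i = trans (≋-cong (λ i → trans (x≋𝟎 i) (sym (zeroˡ 0#))) i)
                             (trans (⊙-homo 0# 𝟎 i) (zeroˡ _))

    ⊖-homo : ∀ x y → f (x ⊖ y) ≋ f x ⊖ f y
    ⊖-homo x y i = trans (≋-cong (⊖-as-⊕ x y) i) (trans (⊕-homo x _ i)
      (trans (+-congˡ (⊙-homo _ y i)) (sym (⊖-as-⊕ (f x) (f y) i))))

    lincomb-homo : ∀ {k} a (v : Vector (Space I) k) → f (lincomb a v) ≋ lincomb a (f ∘ v)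
    lincomb-homo {zero}  a v = 𝟎-homo λ _ → refl
    lincomb-homo {suc k} a v i = trans (⊕-homo (a zero ⊙ v zero) (lincomb (a ∘ suc) (v ∘ suc)) i)
      (+-cong (⊙-homo _ _ i) (lincomb-homo (a ∘ suc) (v ∘ suc) i))

  record Subspace {I : Set} {p} (P : Pred (Space I) p) : Set (c L.⊔ ℓ₁ L.⊔ p) where
    field
      ≋-closed : ∀ {x y} → x ≋ y → P x → P y
      𝟎-closed : P 𝟎
      ⊕-closed : ∀ {x y} → P x → P y → P (x ⊕ y)
      ⊙-closed : ∀ a {x} → P x → P (a ⊙ x)

    ⊖-closed : ∀ {x y} → P x → P y → P (x ⊖ y)
    ⊖-closed {x} {y} Px Py = ≋-closed (λ i → sym (⊖-as-⊕ x y i)) (⊕-closed Px (⊙-closed _ Py))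

    lincomb-closed : ∀ {k} a (v : Vector (Space I) k) → (∀ j → P (v j)) → P (lincomb a v)
    lincomb-closed {zero}  a v Pv = 𝟎-closed
    lincomb-closed {suc k} a v Pv = ⊕-closed (⊙-closed _ (Pv zero)) (lincomb-closed (a ∘ suc) (v ∘ suc) (Pv ∘ suc))

    ⟨⟩⊆ : ∀ {k} {v : Vector (Space I) k} → (∀ j → P (v j)) → ⟨ v ⟩ ⊆ P
    ⟨⟩⊆ {v = v} Pv (a , x≋) = ≋-closed (λ i → sym (x≋ i)) (lincomb-closed a v Pv)

  open Linear public
  open Subspace public

  ·-linear : ∀ {m n} (b : Matrix m n) → Linear (b ·_)
  ·-linear b = record
    { ≋-cong = λ x≋y i → dot-congʳ _ x≋y
    ; ⊕-homo = λ x y i → dot-⊕ _ x y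
    ; ⊙-homo = λ a x i → dot-⊙ _ a x
    }

  ∘-linear : ∀ {I J K : Set} {f : Space J → Space K} {g : Space I → Space J} → Linear f → Linear g → Linear (f ∘ g)
  ∘-linear {f = f} {g} lf lg = record
    { ≋-cong = λ x≋y → ≋-cong lf (≋-cong lg x≋y)
    ; ⊕-homo = λ x y i → trans (≋-cong lf (⊕-homo lg x y) i) (⊕-homo lf (g x) (g y) i)
    ; ⊙-homo = λ a x i → trans (≋-cong lf (⊙-homo lg a x) i) (⊙-homo lf a (g x) i)
    }

  id-⊖-linear : ∀ {I : Set} {f : Space I → Space I} → Linear f → Linear (λ x → x ⊖ f x)
  id-⊖-linear {f = f} lf = record
    { ≋-cong = λ x≋y i → +-cong (x≋y i) (-‿cong (≋-cong lf x≋y i))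
    ; ⊕-homo = λ x y i → begin
        (x i + y i) - f (x ⊕ y) i               ≈⟨ ⊖-as-⊕ (x ⊕ y) (f (x ⊕ y)) i ⟩
        (x i + y i) + - 1# * f (x ⊕ y) i        ≈⟨ +-congˡ (trans (*-congˡ (⊕-homo lf x y i)) (distribˡ _ _ _)) ⟩
        (x i + y i) + (- 1# * f x i + - 1# * f y i) ≈⟨ interchange _ _ _ _ ⟩
        (x i + - 1# * f x i) + (y i + - 1# * f y i) ≈⟨ +-cong (⊖-as-⊕ x (f x) i) (⊖-as-⊕ y (f y) i) ⟨
        (x i - f x i) + (y i - f y i) ∎
    ; ⊙-homo = λ a x i → trans (+-congˡ (-‿cong (⊙-homo lf a x i))) (sym (x[y-z]≈xy-xz a (x i) (f x i)))
    }
    where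
    interchange : ∀ p q r s → (p + q) + (r + s) ≈ (p + r) + (q + s)
    interchange p q r s = begin
      (p + q) + (r + s) ≈⟨ +-assoc p q _ ⟩
      p + (q + (r + s)) ≈⟨ +-congˡ (trans (sym (+-assoc q r s)) (trans (+-congʳ (+-comm q r)) (+-assoc r q s))) ⟩
      p + (r + (q + s)) ≈⟨ +-assoc p r _ ⟨
      (p + r) + (q + s) ∎

  linear≋𝟎 : ∀ {n J} {f : Space (Fin n) → Space J} → Linear f → (∀ c → f (δ c) ≋ 𝟎) → ∀ x → f x ≋ 𝟎
  linear≋𝟎 lf fδ≋𝟎 x i = trans (≋-cong lf (lincomb-δ x) i)
    (trans (lincomb-homo lf x δ i) (dot-𝟎 x λ c → fδ≋𝟎 c i))

  lincomb-· : ∀ {m n k} a (B : Vector (Matrix m n) k) x → lincomb a B · x ≋ lincomb a (λ j → B j · x)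
  lincomb-· a B x i = dot-lincombˡ a (λ j q → B j (i , q)) x

  lincomb-lincomb : ∀ {I : Set} {k l} a (b : Fin k → Fin l → Carrier) (u : Vector (Space I) l) →
    lincomb a (λ j → lincomb (b j) u) ≋ lincomb (lincomb a b) u
  lincomb-lincomb a b u i = sym (dot-lincombˡ a b (λ j → u j i))

  lincomb-congˡ : ∀ {I : Set} {k} {a b : Fin k → Carrier} (v : Vector (Space I) k) → a ≋ b → lincomb a v ≋ lincomb b v
  lincomb-congˡ v a≋b i = dot-cong {y = λ j → v j i} a≋b λ _ → refl

  lincomb-congʳ : ∀ {I : Set} {k} (a : Fin k → Carrier) {v w : Vector (Space I) k} → (∀ j → v j ≋ w j) → lincomb a v ≋ lincomb a w
  lincomb-congʳ a v≋w i = dot-congʳ a λ j → v≋w j i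

  ⟨⟩-subspace : ∀ {I : Set} {k} (v : Vector (Space I) k) → Subspace ⟨ v ⟩
  ⟨⟩-subspace v = record
    { ≋-closed = λ { x≋y (a , x≋) → a , λ i → trans (sym (x≋y i)) (x≋ i) }
    ; 𝟎-closed = 𝟎 , λ i → sym (dot-𝟎ˡ (λ j → v j i))
    ; ⊕-closed = λ { (a , x≋) (b , y≋) → a ⊕ b , λ i → trans (+-cong (x≋ i) (y≋ i))
        (sym (dot-⊕ˡ a b (λ j → v j i))) }
    ; ⊙-closed = λ { a (b , x≋) → a ⊙ b , λ i → trans (*-congˡ (x≋ i)) (sym (dot-⊙ˡ a b (λ j → v j i))) }
    }

  Image-subspace : ∀ {m n} (b : Matrix m n) → Subspace (Image b)
  Image-subspace b = record
    { ≋-closed = λ { x≋y (z , x≋) → z , λ i → trans (sym (x≋y i)) (x≋ i) }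
    ; 𝟎-closed = 𝟎 , λ i → sym (𝟎-homo (·-linear b) (λ _ → refl) i)
    ; ⊕-closed = λ { (z , x≋) (w , y≋) → z ⊕ w , λ i → trans (+-cong (x≋ i) (y≋ i)) (sym (⊕-homo (·-linear b) z w i)) }
    ; ⊙-closed = λ { a (z , x≋) → a ⊙ z , λ i → trans (*-congˡ (x≋ i)) (sym (⊙-homo (·-linear b) a z i)) }
    }

  ∈⟨⟩ : ∀ {I : Set} {k} (v : Vector (Space I) k) j → v j ∈ ⟨ v ⟩
  ∈⟨⟩ v j = δ j , λ i → sym (dot-δ j (λ k → v k i))

  ⟨⟩-tail : ∀ {I : Set} {k} (v : Vector (Space I) (suc k)) → ⟨ v ∘ suc ⟩ ⊆ ⟨ v ⟩
  ⟨⟩-tail v = ⟨⟩⊆ (⟨⟩-subspace v) (∈⟨⟩ v ∘ suc)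

  -- Induction on l: at a nonzero coordinate p of the first vector, the other vectors are made zero.
  -- They stay independent when p is deleted, as nothing is lost there.
  independent⇒≤ : ∀ {k l} (v : Vector (Space (Fin l)) k) → LinearlyIndependent v → k ℕ.≤ l
  independent⇒≤ {zero} v indep = ℕ.z≤n
  independent⇒≤ {suc k} v indep with zero⊎nonzeroEntry (v zero)
  ... | inj₁ v₀≈0 = contradiction (indep (δ zero) (λ i → trans (dot-δ zero (λ j → v j i)) (v₀≈0 i)) zero) 1≉0
  independent⇒≤ {suc k} {suc l} v indep | inj₂ (p , pivot) =
    ℕ.s≤s (independent⇒≤ (λ j → reduced j ∘ punchIn p) λ a ≋𝟎 → indep (lift a) (vanishes a ≋𝟎) ∘ suc)
    where
    v₀ = v zero
    ratio : Fin k → Carrier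
    ratio j = v (suc j) p * inverse (v₀ p)
    reduced : Vector (Space (Fin (suc l))) k
    reduced j = v (suc j) ⊖ ratio j ⊙ v₀
    lift : (Fin k → Carrier) → Fin (suc k) → Carrier
    -- The first coefficient collects the multiples of `v₀` which were subtracted in `reduced`.
    lift a = - dot a ratio ∷ a
    lift-correct : ∀ a q → lincomb (lift a) v q ≈ lincomb a reduced q
    lift-correct a q = begin
      - dot a ratio * v₀ q + dot a (λ j → v (suc j) q)      ≈⟨ +-comm _ _ ⟩
      dot a (λ j → v (suc j) q) + - dot a ratio * v₀ q      ≈⟨ +-congˡ (-‿distribˡ-* _ _) ⟨
      dot a (λ j → v (suc j) q) - dot a ratio * v₀ q        ≈⟨ +-congˡ (-‿cong (trans (*-comm _ _)
                                                               (trans (sym (dot-⊙ a (v₀ q) ratio)) (dot-congʳ a (λ j → *-comm _ _))))) ⟩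
      dot a (λ j → v (suc j) q) - dot a (λ j → ratio j * v₀ q) ≈⟨ dot-⊖ a _ _ ⟨
      lincomb a reduced q ∎
    reduced-p : ∀ j → reduced j p ≈ 0#
    reduced-p j = x≈y⇒x∙y⁻¹≈ε (sym (trans (*-assoc _ _ _) (trans (*-congˡ (inverseˡ pivot)) (*-identityʳ _))))
    vanishes : ∀ a → lincomb a (λ j → reduced j ∘ punchIn p) ≋ 𝟎 → lincomb (lift a) v ≋ 𝟎
    vanishes a ≋𝟎 q with p ≟ᶠ q
    ... | yes ≡-refl = trans (lift-correct a q) (dot-𝟎 a reduced-p)
    ... | no p≢q = trans (lift-correct a q)
      (subst (λ q → lincomb a reduced q ≈ 0#) (punchIn-punchOut p≢q) (≋𝟎 (punchOut p≢q)))

  -- Steinitz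
  independent-in-span⇒≤ : ∀ {I : Set} {k l} {v : Vector (Space I) k} {u : Vector (Space I) l} →
    LinearlyIndependent v → (∀ j → v j ∈ ⟨ u ⟩) → k ℕ.≤ l
  independent-in-span⇒≤ {v = v} {u} indep v∈ = independent⇒≤ (proj₁ ∘ v∈) λ a ≋𝟎 → indep a λ i → begin
    lincomb a v i                                ≈⟨ lincomb-congʳ a (proj₂ ∘ v∈) i ⟩
    lincomb a (λ j → lincomb (proj₁ (v∈ j)) u) i ≈⟨ lincomb-lincomb a (proj₁ ∘ v∈) u i ⟩
    lincomb (lincomb a (proj₁ ∘ v∈)) u i         ≈⟨ lincomb-congˡ u ≋𝟎 i ⟩
    lincomb 𝟎 u i                                ≈⟨ dot-𝟎ˡ (λ j → u j i) ⟩
    0#                                           ∎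

  -- A relation with nonzero first coefficient could be solved for `v zero`.
  independent-∷ : ∀ {I : Set} {k} (v : Vector (Space I) (suc k)) →
    LinearlyIndependent (v ∘ suc) → ¬ v zero ∈ ⟨ v ∘ suc ⟩ → LinearlyIndependent v
  independent-∷ v indep v₀∉ a ≋𝟎 with zero⊎nonzero (a zero)
  ... | inj₁ a₀≈0 = λ { zero → a₀≈0 ; (suc j) → indep (a ∘ suc) (λ i → begin
      lincomb (a ∘ suc) (v ∘ suc) i                        ≈⟨ +-identityˡ _ ⟨
      0# + lincomb (a ∘ suc) (v ∘ suc) i                   ≈⟨ +-congʳ (trans (*-congʳ a₀≈0) (zeroˡ _)) ⟨
      lincomb a v i                                        ≈⟨ ≋𝟎 i ⟩
      0# ∎) j }
  ... | inj₂ a₀#0 = contradiction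
      (≋-closed (⟨⟩-subspace _) (λ i → begin
        inverse (a zero) * (0# - w i)                        ≈⟨ *-congˡ (+-congʳ (≋𝟎 i)) ⟨
        inverse (a zero) * ((a zero * v zero i + w i) - w i) ≈⟨ *-congˡ (trans (+-assoc _ _ _) (trans (+-congˡ (-‿inverseʳ _)) (+-identityʳ _))) ⟩
        inverse (a zero) * (a zero * v zero i)               ≈⟨ trans (sym (*-assoc _ _ _)) (trans (*-congʳ (inverseˡ a₀#0)) (*-identityˡ _)) ⟩
        v zero i ∎)
        (⊙-closed (⟨⟩-subspace _) (inverse (a zero)) (⊖-closed (⟨⟩-subspace _) (𝟎-closed (⟨⟩-subspace _)) (a ∘ suc , λ _ → refl))))
      v₀∉
    where
    w = lincomb (a ∘ suc) (v ∘ suc)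

  HasDim-mono : ∀ {I : Set} {p q d e} {S : Pred (Space I) p} {T : Pred (Space I) q} →
    HasDim S d → HasDim T e → S ⊆ T → d ℕ.≤ e
  HasDim-mono (v , indep , S≐) (u , _ , T≐) S⊆T =
    independent-in-span⇒≤ indep λ j → proj₁ T≐ (S⊆T (proj₂ S≐ (∈⟨⟩ v j)))

  ⊖-cancel : ∀ {I : Set} (x y : Space I) → (x ⊖ y) ⊕ y ≋ x
  ⊖-cancel x y i = trans (+-assoc _ _ _) (trans (+-congˡ (-‿inverseˡ _)) (+-identityʳ _))

  ⊕-cancel : ∀ {I : Set} (x y : Space I) → (x ⊕ y) ⊖ x ≋ y
  ⊕-cancel x y i = trans (+-congʳ (+-comm _ _)) (trans (+-assoc _ _ _) (trans (+-congˡ (-‿inverseʳ _)) (+-identityʳ _)))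

  ⊖≋𝟎⇒≋ : ∀ {I : Set} {x y : Space I} → x ⊖ y ≋ 𝟎 → x ≋ y
  ⊖≋𝟎⇒≋ {x = x} {y} x⊖y≋𝟎 i = trans (sym (⊖-cancel x y i)) (trans (+-congʳ (x⊖y≋𝟎 i)) (+-identityˡ _))

  ≋⇒⊖≋𝟎 : ∀ {I : Set} {x y : Space I} → x ≋ y → x ⊖ y ≋ 𝟎
  ≋⇒⊖≋𝟎 x≋y i = trans (+-congʳ (x≋y i)) (-‿inverseʳ _)

-- Biorthogonal systems and the correctness of Gaussian elimination.

module Biorthogonality {c ℓ₁ ℓ₂} (F : DiscreteField c ℓ₁ ℓ₂) where
  open LinearAlgebra F public
  open RingProperties ring using (x≈y⇒x∙y⁻¹≈ε; x∙y⁻¹≈ε⇒x≈y)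
  open import Relation.Binary.Reasoning.Setoid setoid

  -- For a biorthogonal system, T followed after `pull` is a projection onto the span of the T xᵢ.
  -- Hence `pull` is a generalised inverse of T as soon as these span the range of T.
  pull : ∀ {m n d} → Vector (Space (Fin n)) d → Vector (Space (Fin m)) d → Space (Fin m) → Space (Fin n)
  pull x φ y = lincomb (λ i → dot (φ i) y) x

  residual : ∀ {m n d} → Matrix m n → Vector (Space (Fin n)) d → Vector (Space (Fin m)) d → Space (Fin n) → Space (Fin n)
  residual T x φ v = v ⊖ pull x φ (T · v)

  dual : ∀ {m n d} → Matrix m n → Vector (Space (Fin n)) d → Vector (Space (Fin m)) d → Carrier → Fin m → Space (Fin m)
  dual T x φ ι p = ι ⊙ (δ p ⊖ lincomb (λ i → (T · x i) p) φ)

  Biorthogonal : ∀ {m n d} → Matrix m n → Vector (Space (Fin n)) d → Vector (Space (Fin m)) d → Set ℓ₁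
  Biorthogonal T x φ = ∀ i j → dot (φ i) (T · x j) ≈ δ i j

  pull-linear : ∀ {m n d} (x : Vector (Space (Fin n)) d) (φ : Vector (Space (Fin m)) d) → Linear (pull x φ)
  pull-linear x φ = record
    { ≋-cong = λ y≋ → lincomb-congˡ x λ i → dot-congʳ (φ i) y≋
    ; ⊕-homo = λ y z i → trans (lincomb-congˡ x (λ j → dot-⊕ (φ j) y z) i) (dot-⊕ˡ _ _ (λ j → x j i))
    ; ⊙-homo = λ a y i → trans (lincomb-congˡ x (λ j → dot-⊙ (φ j) a y) i) (dot-⊙ˡ a _ (λ j → x j i))
    }

  residual-linear : ∀ {m n d} (T : Matrix m n) (x : Vector (Space (Fin n)) d) φ → Linear (residual T x φ)
  residual-linear T x φ = id-⊖-linear (∘-linear (pull-linear x φ) (·-linear T))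

  pull∈⟨⟩ : ∀ {m n d} (x : Vector (Space (Fin n)) d) (φ : Vector (Space (Fin m)) d) y → pull x φ y ∈ ⟨ x ⟩
  pull∈⟨⟩ x φ y = (λ i → dot (φ i) y) , λ _ → refl

  dot-δʳ : ∀ {n} (x : Space (Fin n)) i → dot x (λ j → δ j i) ≈ x i
  dot-δʳ x i = sym (lincomb-δ x i)

  module _ {m n d} (T : Matrix m n) (x : Vector (Space (Fin n)) d) (φ : Vector (Space (Fin m)) d) (biorth : Biorthogonal T x φ) where

    dot-lincomb-T : ∀ i a → dot (φ i) (lincomb a (λ j → T · x j)) ≈ a i
    dot-lincomb-T i a = begin
      dot (φ i) (lincomb a (λ j → T · x j))  ≈⟨ dot-lincomb (φ i) a _ ⟩
      dot a (λ j → dot (φ i) (T · x j))      ≈⟨ dot-congʳ a (λ j → trans (biorth i j) (δ-sym i j)) ⟩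
      dot a (λ j → δ j i)                    ≈⟨ dot-δʳ a i ⟩
      a i                                    ∎

    biorthogonal⇒independent : LinearlyIndependent (λ j → T · x j)
    biorthogonal⇒independent a ≋𝟎 i = trans (sym (dot-lincomb-T i a)) (dot-𝟎 (φ i) ≋𝟎)

    dot-residual : ∀ i v → dot (φ i) (T · residual T x φ v) ≈ 0#
    dot-residual i v = begin
      dot (φ i) (T · residual T x φ v)
        ≈⟨ dot-congʳ (φ i) (⊖-homo (·-linear T) v _) ⟩
      dot (φ i) (T · v ⊖ T · pull x φ (T · v))
        ≈⟨ dot-⊖ (φ i) _ _ ⟩
      dot (φ i) (T · v) - dot (φ i) (T · pull x φ (T · v))
        ≈⟨ x≈y⇒x∙y⁻¹≈ε (sym (trans (dot-congʳ (φ i) (lincomb-homo (·-linear T) _ x)) (dot-lincomb-T i _))) ⟩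
      0# ∎

    T-residual≋𝟎⇒ : ∀ v → T · residual T x φ v ≋ 𝟎 → T · v ≋ T · pull x φ (T · v)
    T-residual≋𝟎⇒ v ≋𝟎 i = x∙y⁻¹≈ε⇒x≈y _ _ (trans (sym (⊖-homo (·-linear T) v _ i)) (≋𝟎 i))

    dot-dual : ∀ ι p y → dot (dual T x φ ι p) y ≈ ι * (y p - dot (λ i → (T · x i) p) (λ i → dot (φ i) y))
    dot-dual ι p y = begin
      dot (dual T x φ ι p) y
        ≈⟨ dot-⊙ˡ ι _ y ⟩
      ι * dot (δ p ⊖ lincomb (λ i → (T · x i) p) φ) y
        ≈⟨ *-congˡ (trans (dot-comm _ y) (dot-⊖ y _ _)) ⟩
      ι * (dot y (δ p) - dot y (lincomb (λ i → (T · x i) p) φ))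
        ≈⟨ *-congˡ (+-cong (trans (dot-comm y _) (dot-δ p y)) (-‿cong (trans (dot-comm y _) (dot-lincombˡ _ φ y)))) ⟩
      ι * (y p - dot (λ i → (T · x i) p) (λ i → dot (φ i) y)) ∎

  -- The matrix of the φᵢ(T xⱼ) gets a new row and a new column. Off the corner, the column vanishes
  -- because x₀ is a residual, and the row because of the correction in `dual`; ι makes the corner
  -- 1.
  biorthogonal-grow : ∀ {m n d} (T : Matrix m n) (x : Vector (Space (Fin n)) (suc d)) (φ : Vector (Space (Fin m)) (suc d)) {ι p v} →
    Biorthogonal T (x ∘ suc) (φ ∘ suc) → x zero ≋ residual T (x ∘ suc) (φ ∘ suc) v → ι * (T · x zero) p ≈ 1# →
    φ zero ≋ dual T (x ∘ suc) (φ ∘ suc) ι p → Biorthogonal T x φ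
  biorthogonal-grow T x φ {ι} {p} {v} biorth x₀≋ ι-inverse φ₀≋ = entry
    where
    dot-φ₀ : ∀ y → dot (φ zero) y ≈ ι * (y p - dot (λ i → (T · x (suc i)) p) (λ i → dot (φ (suc i)) y))
    dot-φ₀ y = trans (dot-cong {y = y} φ₀≋ λ _ → refl) (dot-dual T (x ∘ suc) (φ ∘ suc) biorth ι p y)
    φ-x₀ : ∀ i → dot (φ (suc i)) (T · x zero) ≈ 0#
    φ-x₀ i = trans (dot-congʳ _ (≋-cong (·-linear T) x₀≋)) (dot-residual T (x ∘ suc) (φ ∘ suc) biorth i v)
    entry : Biorthogonal T x φ
    entry zero    zero    = begin
      dot (φ zero) (T · x zero)                ≈⟨ dot-φ₀ (T · x zero) ⟩
      ι * ((T · x zero) p - dot (λ i → (T · x (suc i)) p) (λ i → dot (φ (suc i)) (T · x zero)))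
                                               ≈⟨ *-congˡ (x-0≈x (dot-𝟎 _ φ-x₀)) ⟩
      ι * (T · x zero) p                       ≈⟨ ι-inverse ⟩
      1#                                       ∎
    entry zero    (suc j) = begin
      dot (φ zero) (T · x (suc j))             ≈⟨ dot-φ₀ (T · x (suc j)) ⟩
      ι * ((T · x (suc j)) p - dot (λ i → (T · x (suc i)) p) (λ i → dot (φ (suc i)) (T · x (suc j))))
        ≈⟨ x*0≈0 (x≈y⇒x∙y⁻¹≈ε (sym (trans (dot-congʳ _ λ i → biorth i j) (dot-δʳ _ j)))) ⟩
      0#                                       ∎
    entry (suc i) zero    = φ-x₀ i
    entry (suc i) (suc j) = biorth i j

  eval-sum : ∀ {I n} (s : Space I) (e : Fin n → Expr I) (φ y : Space (Fin n)) → (∀ q → eval s (e q) ≈ φ q * y q) →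
    eval s (sumᴱ e) ≈ dot φ y
  eval-sum {n = zero}  s e φ y e≈ = refl
  eval-sum {n = suc n} s e φ y e≈ = +-cong (e≈ zero) (eval-sum s (e ∘ suc) (φ ∘ suc) (y ∘ suc) (e≈ ∘ suc))

  eval-dot : ∀ {I n} (s : Space I) (φ y : Fin n → Expr I) {φ′ y′ : Space (Fin n)} →
    eval s ∘ φ ≋ φ′ → eval s ∘ y ≋ y′ → eval s (dotᴱ φ y) ≈ dot φ′ y′
  eval-dot s φ y φ≋ y≋ = eval-sum s _ _ _ λ q → *-cong (φ≋ q) (y≋ q)

  eval-· : ∀ {I m n} (s : Space I) (b : Fin m × Fin n → Expr I) (x : Fin n → Expr I) {b′ : Matrix m n} {x′} →
    eval s ∘ b ≋ b′ → eval s ∘ x ≋ x′ → eval s ∘ (b ·ᴱ x) ≋ b′ · x′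
  eval-· s b x b≋ x≋ i = eval-dot s _ x (λ j → b≋ (i , j)) x≋

  eval-δ : ∀ {I n} (s : Space I) (p : Fin n) → eval s ∘ δᴱ p ≋ δ p
  eval-δ s zero    zero    = refl
  eval-δ s zero    (suc j) = refl
  eval-δ s (suc i) zero    = refl
  eval-δ s (suc i) (suc j) = eval-δ s i j

  module _ {I : Set} (s : Space I) {m n d} (x : Fin d → Fin n → Expr I) (φ : Fin d → Fin m → Expr I) where

    eval-pull : ∀ y {y′} → eval s ∘ y ≋ y′ →
      eval s ∘ pullᴱ x φ y ≋ pull (λ i → eval s ∘ x i) (λ i → eval s ∘ φ i) y′
    eval-pull y y≋ a = eval-dot s (λ i → dotᴱ (φ i) y) _ (λ i → eval-dot s (φ i) y (λ _ → refl) y≋) (λ i → refl)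

    module _ (T : Fin m × Fin n → Expr I) {T′ : Matrix m n} (T≋ : eval s ∘ T ≋ T′) where

      eval-residual : ∀ v {v′} → eval s ∘ v ≋ v′ →
        eval s ∘ residualᴱ T x φ v ≋ residual T′ (λ i → eval s ∘ x i) (λ i → eval s ∘ φ i) v′
      eval-residual v v≋ a = +-cong (v≋ a) (-‿cong (eval-pull (T ·ᴱ v) (eval-· s T v T≋ v≋) a))

      eval-dual : ∀ ι p → eval s ∘ dualᴱ T x φ ι p ≋ dual T′ (λ i → eval s ∘ x i) (λ i → eval s ∘ φ i) (eval s ι) p
      eval-dual ι p q = *-congˡ (+-cong (eval-δ s p q) (-‿cong
        (eval-dot s _ _ (λ i → eval-· s T (x i) T≋ (λ _ → refl) p) (λ i → refl))))

  vectors : ∀ {B n m d} → Space (System B n m d) → Vector (Space (Fin n)) d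
  vectors s i a = s (inj₂ (i , inj₁ a))

  functionals : ∀ {B n m d} → Space (System B n m d) → Vector (Space (Fin m)) d
  functionals s i q = s (inj₂ (i , inj₂ q))

  module _ {C : Container 0ℓ 0ℓ} {B : Set} {n m : ℕ} (T : Fin m × Fin n → Expr B) {N : ℕ → ℕ} {Candidate : ℕ → Set}
    (enum : ∀ d → Fin (N d) ↔ Candidate d) (candidate : ∀ d → Candidate d → Fin n → Expr (System B n m d))
    (done : ∀ d → Machine C (System B n m d)) where

    open Saturation T enum candidate done

    module _ (s₀ : Space B) {T′ : Matrix m n} (T≋ : eval s₀ ∘ T ≋ T′)
      {p} (Invariant : ∀ d → Vector (Space (Fin n)) d → Set p)
      (grow : ∀ {d} (s : Space (System B n m d)) → s ∘ inj₁ ≡ s₀ → ∀ c (x : Vector (Space (Fin n)) (suc d)) φ →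
              Biorthogonal T′ x φ → x ∘ suc ≡ vectors s →
              x zero ≋ residual T′ (vectors s) (functionals s) (eval s ∘ candidate d c) →
              Invariant d (vectors s) → Invariant (suc d) x)
      {q} (Q : ⟦ C ⟧ Carrier → Set q) where

      -- `Invariant` carries a caller's knowledge about the vectors through all rounds. `done` is
      -- reached only when T kills the residual of every candidate, that is, when no candidate has a
      -- new image.
      ensures-saturate : ∀ fuel d (s : Space (System B n m d)) → d ℕ.+ fuel ≡ suc m → s ∘ inj₁ ≡ s₀ →
        Biorthogonal T′ (vectors s) (functionals s) → Invariant d (vectors s) →
        (∀ d (s : Space (System B n m d)) → s ∘ inj₁ ≡ s₀ → Biorthogonal T′ (vectors s) (functionals s) →
          Invariant d (vectors s) →
          (∀ c → T′ · residual T′ (vectors s) (functionals s) (eval s ∘ candidate d c) ≋ 𝟎) → Ensures Q (done d) s) →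
        Ensures Q (saturate fuel d) s
      -- The fuel never runs out: there would be m + 1 independent images in a space of dimension m.
      ensures-saturate zero d s d≡ s≡ biorth invariant H = contradiction
        (independent⇒≤ (λ j → T′ · vectors s j) (biorthogonal⇒independent T′ (vectors s) (functionals s) biorth))
        (ℕₚ.<⇒≱ (ℕₚ.≤-reflexive (≡-trans (≡-sym d≡) (ℕₚ.+-identityʳ d))))
      ensures-saturate (suc fuel) d s d≡ s≡ biorth invariant H = ensures-search Q (enum d ×ᶠ fin m) {newImage d}
        (λ { (c , p) pivot → step {e = [ newVector d c , newFunctional d (c , p) ]} λ { s′ ≡-refl s′≡ →
          let x₀≋ : vectors (s′ ∘ enlarge) zero ≋ residual T′ (vectors s) (functionals s) (eval s ∘ candidate d c)
              x₀≋ = λ a → trans (reflexive (s′≡ (inj₁ a))) (eval-newVector d s s≡ c a)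
              biorth′ : Biorthogonal T′ (vectors (s′ ∘ enlarge)) (functionals (s′ ∘ enlarge))
              biorth′ = biorthogonal-grow T′ (vectors (s′ ∘ enlarge)) (functionals (s′ ∘ enlarge)) biorth x₀≋
                (trans (*-congˡ (trans (≋-cong (·-linear T′) x₀≋ p) (sym (eval-newImage d s s≡ c p)))) (inverseˡ pivot))
                (λ q → trans (reflexive (s′≡ (inj₂ q)))
                  (eval-dual s vectorᴱ functionalᴱ (T↑ d) (T↑≋ d s s≡) (invᴱ (newImage d (c , p))) p q))
          in ensures-saturate fuel (suc d) (s′ ∘ enlarge) (≡-trans (≡-sym (ℕₚ.+-suc d fuel)) d≡) s≡ biorth′
               (grow s s≡ c _ _ biorth′ ≡-refl x₀≋ invariant) H } })
        (λ images≈0 → H d s s≡ biorth invariant λ c p → trans (sym (eval-newImage d s s≡ c p)) (images≈0 (c , p)))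
        where
        T↑≋ : ∀ d (s : Space (System B n m d)) → s ∘ inj₁ ≡ s₀ → eval s ∘ T↑ d ≋ T′
        T↑≋ d s ≡-refl ij = trans (reflexive (eval-rename inj₁ s (T ij))) (T≋ ij)
        eval-newVector : ∀ d (s : Space (System B n m d)) → s ∘ inj₁ ≡ s₀ → ∀ c →
          eval s ∘ newVector d c ≋ residual T′ (vectors s) (functionals s) (eval s ∘ candidate d c)
        eval-newVector d s s≡ c = eval-residual s vectorᴱ functionalᴱ (T↑ d) (T↑≋ d s s≡) (candidate d c) λ _ → refl
        eval-newImage : ∀ d (s : Space (System B n m d)) → s ∘ inj₁ ≡ s₀ → ∀ c p → eval s (newImage d (c , p)) ≈
          (T′ · residual T′ (vectors s) (functionals s) (eval s ∘ candidate d c)) p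
        eval-newImage d s s≡ c = eval-· s (T↑ d) (newVector d c) (T↑≋ d s s≡) (eval-newVector d s s≡ c)

      ensures-gauss : (∀ x → Invariant 0 x) →
        (∀ d (s : Space (System B n m d)) → s ∘ inj₁ ≡ s₀ → Biorthogonal T′ (vectors s) (functionals s) →
          Invariant d (vectors s) →
          (∀ c → T′ · residual T′ (vectors s) (functionals s) (eval s ∘ candidate d c) ≋ 𝟎) → Ensures Q (done d) s) →
        Ensures Q gauss s₀
      ensures-gauss initial H = step λ s s≡ _ → ensures-saturate (suc m) 0 _ ≡-refl s≡ (λ ()) (initial _) H

-- From an equation of sums in ℕ to the subtraction in ℤ of the rank formula.

module Integers where
  open ℤ using (+_)

  m+e≡r+d⇒r≡m-[d-e] : ∀ {m d e r} → m ℕ.+ e ≡ r ℕ.+ d → + r ≡ + m ℤ.- (+ d ℤ.- + e)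
  m+e≡r+d⇒r≡m-[d-e] {m} {d} {e} {r} m+e≡r+d = ≡-sym (begin
    + m ℤ.- (+ d ℤ.- + e)           ≡⟨ cong (λ i → + m ℤ.+ i) (≡-trans (ℤₚ.neg-distrib-+ (+ d) (ℤ.- + e))
                                         (≡-trans (cong (λ i → ℤ.- + d ℤ.+ i) (ℤₚ.neg-involutive (+ e)))
                                                  (ℤₚ.+-comm (ℤ.- + d) (+ e)))) ⟩
    + m ℤ.+ (+ e ℤ.- + d)           ≡⟨ ℤₚ.+-assoc (+ m) (+ e) (ℤ.- + d) ⟨
    + (m ℕ.+ e) ℤ.- + d             ≡⟨ cong (λ i → + i ℤ.- + d) m+e≡r+d ⟩
    (+ r ℤ.+ + d) ℤ.- + d           ≡⟨ ℤₚ.+-assoc (+ r) (+ d) (ℤ.- + d) ⟩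
    + r ℤ.+ (+ d ℤ.- + d)           ≡⟨ cong (λ i → + r ℤ.+ i) (ℤₚ.+-inverseʳ (+ d)) ⟩
    + r ℤ.+ + 0                     ≡⟨ ℤₚ.+-identityʳ (+ r) ⟩
    + r                             ∎)
    where open ≡-Reasoning

open Integers

-- Rank, dimension, and the rank formula for a closed subspace.

module Dimension {c ℓ₁ ℓ₂} (F : DiscreteField c ℓ₁ ℓ₂) where
  open import Data.Vec.Functional using ([]; _∷_)
  open Biorthogonality F public
  open RingProperties ring using (x≈y⇒x∙y⁻¹≈ε; -1*x≈-x)
  open import Relation.Binary.Reasoning.Setoid setoid

  residuals-of-units : ∀ {I m n d} (T : Matrix m n) (x : Vector (Space (Fin n)) d) φ (s : Space I) →
    (∀ c → T · residual T x φ (eval s ∘ δᴱ c) ≋ 𝟎) → ∀ z → T · residual T x φ z ≋ 𝟎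
  residuals-of-units T x φ s ≋𝟎 = linear≋𝟎 linear λ c i → trans (≋-cong linear (λ j → sym (eval-δ s c j)) i) (≋𝟎 c i)
    where
    linear : Linear (λ z → T · residual T x φ z)
    linear = ∘-linear (·-linear T) (residual-linear T x φ)

  module _ {m n} (T : Matrix m n) {p} (Invariant : ∀ d → Vector (Space (Fin n)) d → Set p)
    (grow : ∀ {d} (x : Vector (Space (Fin n)) (suc d)) φ → Biorthogonal T x φ → Invariant d (x ∘ suc) → Invariant (suc d) x) where

    abstract
      -- Existence is proved by running the elimination: a program without output is certified with
      -- a postcondition that ignores the output and states the goal. `abstract` keeps this run from
      -- being unfolded.
      extend-to-spanning : ∀ {d} (x : Vector (Space (Fin n)) d) φ → Biorthogonal T x φ → Invariant d x →
        ∃[ d′ ] Σ[ x′ ∈ Vector (Space (Fin n)) d′ ] Σ[ φ′ ∈ _ ]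
          Biorthogonal T x′ φ′ × Invariant d′ x′ × (∀ z → T · z ∈ ⟨ (λ j → T · x′ j) ⟩)
      extend-to-spanning {d} x φ biorth invariant = run-compile {C = ⊤ ▷ λ _ → ⊥} (λ _ → Goal) id s
        (ensures-saturate {C = ⊤ ▷ λ _ → ⊥} var (λ _ → fin n) (λ _ → δᴱ) (λ _ → halt (tt , λ ())) T (λ _ → refl) Invariant
          (λ s _ c x φ biorth x≡ _ invariant → grow x φ biorth (subst (Invariant _) (≡-sym x≡) invariant))
          -- The fuel has to complement d to m + 1; d is at most m since the images are independent.
          (λ _ → Goal) (suc m ℕ.∸ d) d s (ℕₚ.m+[n∸m]≡n (ℕₚ.m≤n⇒m≤1+n d≤m)) ≡-refl biorth invariant
          λ d s _ biorth invariant residuals≋𝟎 → halt (d , vectors s , functionals s , biorth , invariant , λ z →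
            ≋-closed (⟨⟩-subspace _)
              (λ i → trans (sym (lincomb-homo (·-linear T) _ (vectors s) i))
                (sym (T-residual≋𝟎⇒ T (vectors s) (functionals s) biorth z
                  (residuals-of-units T (vectors s) (functionals s) s residuals≋𝟎 z) i)))
              ((λ i → dot (functionals s i) (T · z)) , λ _ → refl)))
        where
        Goal : Set (c L.⊔ ℓ₁ L.⊔ p)
        Goal = ∃[ d′ ] Σ[ x′ ∈ Vector (Space (Fin n)) d′ ] Σ[ φ′ ∈ _ ]
          Biorthogonal T x′ φ′ × Invariant d′ x′ × (∀ z → T · z ∈ ⟨ (λ j → T · x′ j) ⟩)
        d≤m : d ℕ.≤ m
        d≤m = independent⇒≤ _ (biorthogonal⇒independent T x φ biorth)
        s : Space (System (Fin m × Fin n) n m d)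
        s (inj₁ ij)           = T ij
        s (inj₂ (i , inj₁ a)) = x i a
        s (inj₂ (i , inj₂ q)) = φ i q

  abstract
    rank : ∀ {m n} (T : Matrix m n) → ∃[ r ] HasRank T r
    rank T with extend-to-spanning T (λ _ _ → ⊤) (λ _ _ _ _ → tt) [] [] (λ ()) tt
    ... | r , x , φ , biorth , _ , spanning = r , (λ j → T · x j) , biorthogonal⇒independent T x φ biorth ,
      (λ { (z , y≋) → ≋-closed (⟨⟩-subspace _) (λ i → sym (y≋ i)) (spanning z) }) ,
      ⟨⟩⊆ (Image-subspace T) λ j → x j , λ _ → refl

    span-dimension : ∀ {m k} (v : Vector (Space (Fin m)) k) → ∃[ e ] HasDim ⟨ v ⟩ e
    span-dimension {m} {k} v = let e , t , indep , Image⊆ , ⊆Image = rank columns in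
      e , t , indep , Image⊆ ∘ ⟨⟩⊆Image , Image⊆⟨⟩ ∘ ⊆Image
      where
      columns : Matrix m k
      columns ij = v (proj₂ ij) (proj₁ ij)
      ⟨⟩⊆Image : ⟨ v ⟩ ⊆ Image columns
      ⟨⟩⊆Image (a , y≋) = a , λ i → trans (y≋ i) (dot-comm a (λ j → v j i))
      Image⊆⟨⟩ : Image columns ⊆ ⟨ v ⟩
      Image⊆⟨⟩ (a , y≋) = a , λ i → trans (y≋ i) (dot-comm (λ j → v j i) a)

  𝐈 : ∀ {n} → Matrix n n
  𝐈 (i , j) = δ i j

  𝐈·≋ : ∀ {n} (x : Space (Fin n)) → 𝐈 · x ≋ x
  𝐈·≋ x i = dot-δ i x

  δ-independent : ∀ {n} → LinearlyIndependent (δ {n})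
  δ-independent a ≋𝟎 j = trans (lincomb-δ a j) (≋𝟎 j)

  independent-cong : ∀ {I : Set} {k} {v w : Vector (Space I) k} → (∀ j → v j ≋ w j) → LinearlyIndependent v → LinearlyIndependent w
  independent-cong v≋w indep a ≋𝟎 = indep a λ i → trans (lincomb-congʳ a v≋w i) (≋𝟎 i)

  𝐈-biorthogonal⇒independent : ∀ {n d} (x φ : Vector (Space (Fin n)) d) → Biorthogonal 𝐈 x φ → LinearlyIndependent x
  𝐈-biorthogonal⇒independent x φ biorth = independent-cong (𝐈·≋ ∘ x) (biorthogonal⇒independent 𝐈 x φ biorth)

  independent⇒∉ : ∀ {I : Set} {k} (v : Vector (Space I) (suc k)) → LinearlyIndependent v → ¬ v zero ∈ ⟨ v ∘ suc ⟩
  independent⇒∉ v indep (a , v₀≋) = 1≉0 (begin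
    1#       ≈⟨ x-0≈x refl ⟨
    1# - 0#  ≈⟨ +-congˡ (-‿cong (indep (1# ∷ λ j → - a j) (λ i → relation i) zero)) ⟨
    1# - 1#  ≈⟨ -‿inverseʳ 1# ⟩
    0#       ∎)
    where
    relation : lincomb (1# ∷ λ j → - a j) v ≋ 𝟎
    relation i = begin
      1# * v zero i + dot (λ j → - a j) (λ j → v (suc j) i)
        ≈⟨ +-cong (trans (*-identityˡ _) (v₀≋ i)) (dot-cong {y = λ j → v (suc j) i} (λ j → sym (-1*x≈-x (a j))) λ _ → refl) ⟩
      lincomb a (v ∘ suc) i + dot ((- 1#) ⊙ a) (λ j → v (suc j) i)
        ≈⟨ +-congˡ (trans (dot-⊙ˡ _ a _) (-1*x≈-x _)) ⟩
      lincomb a (v ∘ suc) i - lincomb a (v ∘ suc) i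
        ≈⟨ -‿inverseʳ _ ⟩
      0# ∎

  grow-∈⟨⟩ : ∀ {I : Set} {k l} (v : Vector (Space I) (suc k)) (w : Vector (Space I) (suc l)) →
    v zero ≋ w zero → (∀ j → v (suc j) ∈ ⟨ w ∘ suc ⟩) → ∀ j → v j ∈ ⟨ w ⟩
  grow-∈⟨⟩ v w v₀≋ v∈ zero    = ≋-closed (⟨⟩-subspace w) (λ i → sym (v₀≋ i)) (∈⟨⟩ w zero)
  grow-∈⟨⟩ v w v₀≋ v∈ (suc j) = ⟨⟩-tail w (v∈ j)

  ≐-trans : ∀ {I : Set} {p q r} {S : Pred (Space I) p} {T : Pred (Space I) q} {U : Pred (Space I) r} → S ≐ T → T ≐ U → S ≐ U
  ≐-trans (S⊆T , T⊆S) (T⊆U , U⊆T) = T⊆U ∘ S⊆T , T⊆S ∘ U⊆T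

  -- The situation when the Wong sequence stops without an escape, with W = ⟨ x ⟩ and with φ
  -- certifying that x is independent. Since h is in L, the last condition gives LW = hW.
  module Closed {m n k d} (A : Vector (Matrix m n) k) (h : Matrix m n) (h∈ : h ∈ ⟨ A ⟩)
    (x φ : Vector (Space (Fin n)) d) (biorth : Biorthogonal 𝐈 x φ)
    (ker⊆ : ∀ z → h · z ≋ 𝟎 → z ∈ ⟨ x ⟩) (A·x∈ : ∀ j i → A j · x i ∈ ⟨ (λ i → h · x i) ⟩) where

    L·x∈ : ∀ {b} → b ∈ ⟨ A ⟩ → ∀ i → b · x i ∈ ⟨ (λ i → h · x i) ⟩
    L·x∈ (a , b≋) i = ≋-closed (⟨⟩-subspace _)
      (λ q → trans (sym (lincomb-· a A (x i) q)) (dot-cong {y = x i} (λ j → sym (b≋ (q , j))) (λ _ → refl)))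
      (lincomb-closed (⟨⟩-subspace _) a (λ j → A j · x i) (λ j → A·x∈ j i))

    L∙⟨x⟩≐ : ⟨ A ⟩ ∙ ⟨ x ⟩ ≐ ⟨ (λ i → h · x i) ⟩
    L∙⟨x⟩≐ =
      (λ { (l , v , v∈ , y∈) → ⟨⟩⊆ (⟨⟩-subspace _) (λ j → product∈ (v∈ j)) y∈ }) ,
      (λ { y∈@(a , y≋) → 1 , (λ _ → h · lincomb a x) ,
         (λ _ → h , lincomb a x , h∈ , (a , λ _ → refl) , λ _ → refl) ,
         ≋-closed (⟨⟩-subspace {k = 1} (λ _ → h · lincomb a x))
           (λ i → trans (lincomb-homo (·-linear h) a x i) (sym (y≋ i))) (∈⟨⟩ (λ _ → h · lincomb a x) zero) })
      where
      product∈ : ∀ {y} → (∃[ b ] ∃[ w ] b ∈ ⟨ A ⟩ × w ∈ ⟨ x ⟩ × y ≋ b · w) → y ∈ ⟨ (λ i → h · x i) ⟩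
      product∈ (b , w , b∈ , (a , w≋) , y≋) = ≋-closed (⟨⟩-subspace _)
        (λ i → trans (sym (lincomb-homo (·-linear b) a x i)) (trans (≋-cong (·-linear b) (λ j → sym (w≋ j)) i) (sym (y≋ i))))
        (lincomb-closed (⟨⟩-subspace _) a _ (L·x∈ b∈))

    e : ℕ
    e = proj₁ (span-dimension (λ i → h · x i))

    dim-e : HasDim ⟨ (λ i → h · x i) ⟩ e
    dim-e = proj₂ (span-dimension (λ i → h · x i))

    -- While W = ⟨ x ⟩ grows to the whole space, the dimensions of hW and of W
    -- keep their difference, since W contains the kernel of h, and the dimension
    -- of bW grows at most as fast as that of hW.
    Invariant : ∀ d′ → Vector (Space (Fin n)) d′ → Set (c L.⊔ ℓ₁)
    Invariant d′ y = ⟨ x ⟩ ⊆ ⟨ y ⟩ × ∃[ e′ ] d′ ℕ.+ e ≡ e′ ℕ.+ d × HasDim ⟨ (λ i → h · y i) ⟩ e′ ×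
      (∀ b → b ∈ ⟨ A ⟩ → Σ[ t ∈ Vector (Space (Fin m)) e′ ] (∀ i → b · y i ∈ ⟨ t ⟩))

    initial : Invariant d x
    initial = id , e , ℕₚ.+-comm d e , dim-e ,
      λ b b∈ → proj₁ dim-e , λ i → proj₁ (proj₂ (proj₂ dim-e)) (L·x∈ b∈ i)

    grow : ∀ {d′} (y : Vector (Space (Fin n)) (suc d′)) ψ → Biorthogonal 𝐈 y ψ → Invariant d′ (y ∘ suc) → Invariant (suc d′) y
    grow y ψ biorth (x⊆y , e′ , e′≡ , (t , indep , hy⊆t , t⊆hy) , small) =
      ⟨⟩-tail y ∘ x⊆y , suc e′ , cong suc e′≡ , (h · y zero ∷ t , independent-∷ (h · y zero ∷ t) indep new∉ ,
        ⟨⟩⊆ (⟨⟩-subspace (h · y zero ∷ t)) (grow-∈⟨⟩ (λ i → h · y i) (h · y zero ∷ t) (λ _ → refl) λ i → hy⊆t (∈⟨⟩ (λ i → h · y (suc i)) i)) ,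
        ⟨⟩⊆ (⟨⟩-subspace (λ i → h · y i)) (grow-∈⟨⟩ (h · y zero ∷ t) (λ i → h · y i) (λ _ → refl) λ i → t⊆hy (∈⟨⟩ t i))) ,
      λ b b∈ → let u , y∈ = small b b∈ in
        b · y zero ∷ u , grow-∈⟨⟩ (λ i → b · y i) (b · y zero ∷ u) (λ _ → refl) y∈
      where
      -- Otherwise `y zero` would differ from a combination of the other vectors by an element of
      -- the kernel of h, which is contained in ⟨ x ⟩ and so in their span.
      new∉ : ¬ h · y zero ∈ ⟨ t ⟩
      new∉ hy₀∈ with t⊆hy hy₀∈
      ... | a , hy₀≋ = independent⇒∉ y (𝐈-biorthogonal⇒independent y ψ biorth)
        (≋-closed (⟨⟩-subspace _)
          (λ i → trans (+-assoc _ _ _) (trans (+-congˡ (-‿inverseˡ _)) (+-identityʳ _)))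
          (⊕-closed (⟨⟩-subspace _)
            (x⊆y (ker⊆ (y zero ⊖ lincomb a (y ∘ suc)) λ i → trans (⊖-homo (·-linear h) _ _ i)
              (x≈y⇒x∙y⁻¹≈ε (trans (hy₀≋ i) (sym (lincomb-homo (·-linear h) a (y ∘ suc) i))))))
            (a , λ _ → refl)))

    -- Let y be the extension of x to a basis of the whole space. Then the h yᵢ span the range of h,
    -- so the invariant reads n + e = rk h + d, and it also puts the range of each b into the span
    -- of rk h vectors.
    maximal : MaximumRank ⟨ A ⟩ h × LinearlyIndependent x × RankFormula ⟨ A ⟩ h ⟨ x ⟩
    maximal with extend-to-spanning 𝐈 Invariant grow x φ biorth initial
    ... | d′ , y , ψ , biorth′ , (_ , r , r≡ , (t , indep , hy⊆t , t⊆hy) , small) , spanning =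
      (h∈ , λ b b∈ → let s , b-rank@(v , v-indep , v⊆ , ⊆v) = rank b ; u , by∈u = small b b∈ in
        s , r , b-rank , h-rank , independent-in-span⇒≤ v-indep λ j →
          let z , v≋ = ⊆v (∈⟨⟩ v j) in image∈ b by∈u v≋) ,
      𝐈-biorthogonal⇒independent x φ biorth ,
      r , d , e , h-rank , (x , 𝐈-biorthogonal⇒independent x φ biorth , id , id) ,
      (proj₁ dim-e , proj₁ (proj₂ dim-e) , ≐-trans L∙⟨x⟩≐ (proj₂ (proj₂ dim-e))) ,
      m+e≡r+d⇒r≡m-[d-e] {n} {d} {e} {r} (subst (λ n′ → n′ ℕ.+ e ≡ r ℕ.+ d) d′≡n r≡)
      where
      y-spans : ∀ z → z ∈ ⟨ y ⟩
      y-spans z = let a , z≋ = spanning z in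
        a , λ i → trans (sym (𝐈·≋ z i)) (trans (z≋ i) (lincomb-congʳ a (𝐈·≋ ∘ y) i))
      d′≡n : d′ ≡ n
      d′≡n = ℕₚ.≤-antisym (independent⇒≤ y (𝐈-biorthogonal⇒independent y ψ biorth′))
                          (independent-in-span⇒≤ δ-independent λ j → y-spans (δ j))
      image∈ : ∀ {k} {u : Vector (Space (Fin m)) k} b {z w} → (∀ i → b · y i ∈ ⟨ u ⟩) → w ≋ b · z → w ∈ ⟨ u ⟩
      image∈ b {z} by∈ w≋ = let a , z≋ = y-spans z in ≋-closed (⟨⟩-subspace _)
        (λ i → trans (sym (lincomb-homo (·-linear b) a y i)) (trans (≋-cong (·-linear b) (λ j → sym (z≋ j)) i) (sym (w≋ i))))
        (lincomb-closed (⟨⟩-subspace _) a _ by∈)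
      h-rank : HasRank h r
      h-rank = t , indep , (λ { (z , w≋) → image∈ h (λ i → hy⊆t (∈⟨⟩ _ i)) w≋ }) ,
        ⟨⟩⊆ (Image-subspace h) (λ i → y i , λ _ → refl) ∘ t⊆hy

-- Paths raise the rank, separating sets confine the Wong sequence.

module Augmentation {c ℓ₁ ℓ₂} (F : DiscreteField c ℓ₁ ℓ₂) where
  open import Data.List.Base using ([]; _∷_)
  open import Data.List.Relation.Unary.All using ([]; _∷_)
  open Dimension F public

  Determines : ∀ {I J : Set} → (Space I → Space J) → Bool → Set (c L.⊔ ℓ₁)
  Determines f b = (b ≡ true → ∃[ z ] ¬ f z ≋ 𝟎) × (b ≡ false → ∀ z → f z ≋ 𝟎)

  strict-image⇒rk< : ∀ {m n} {h h′ : Matrix m n} → Image h ⊆ Image h′ → ∀ {y} → y ∈ Image h′ → ¬ y ∈ Image h → h rk< h′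
  strict-image⇒rk< {h = h} {h′} h⊆h′ {y} y∈h′ y∉h =
    let r , v , indep , Image⊆ , ⊆Image = rank h ; s , h′-rank@(u , _ , Image′⊆ , _) = rank h′ in
    r , s , (v , indep , Image⊆ , ⊆Image) , h′-rank ,
    independent-in-span⇒≤ {v = y V.∷ v} {u} (independent-∷ (y V.∷ v) indep (y∉h ∘ ⊆Image))
      λ { zero → Image′⊆ y∈h′ ; (suc j) → Image′⊆ (h⊆h′ (⊆Image (∈⟨⟩ v j))) }

  rk<⇒¬maximal : ∀ {m n p} {L : Pred (Matrix m n) p} {h h′} → h′ ∈ L → h rk< h′ → ¬ MaximumRank L h
  rk<⇒¬maximal h′∈ (r , s , h-rank , h′-rank , r<s) (_ , max) =
    let s′ , r′ , h′-rank′ , h-rank′ , s′≤r′ = max _ h′∈ in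
    -- The strict inequality and the maximality bring their own ranks of the same two matrices,
    -- which `HasDim-mono` has to compare.
    ℕₚ.<⇒≱ r<s (ℕₚ.≤-trans (HasDim-mono h′-rank h′-rank′ id) (ℕₚ.≤-trans s′≤r′ (HasDim-mono h-rank′ h-rank id)))

  -- Both values are multiples of the one basis vector of the range, and the coefficient of the
  -- nonzero one is invertible. Thus a single nonzero value in a subspace puts the whole range
  -- there.
  rank-one-multiple : ∀ {m n} {r : Matrix m n} → HasRank r 1 → ∀ x → ¬ r · x ≋ 𝟎 → ∀ z → r · z ∈ ⟨ (λ (_ : Fin 1) → r · x) ⟩
  rank-one-multiple {r = r} (v , _ , Image⊆ , _) x rx≉𝟎 z with Image⊆ (x , λ _ → refl) | Image⊆ (z , λ _ → refl)
  ... | a , rx≋ | b , rz≋ with zero⊎nonzero (a zero)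
  ...   | inj₁ a≈0 = contradiction (λ i → trans (rx≋ i) (trans (+-identityʳ _) (trans (*-congʳ a≈0) (zeroˡ _)))) rx≉𝟎
  ...   | inj₂ a#0 = (λ _ → b zero * inverse (a zero)) , λ i → begin
          (r · z) i                                                     ≈⟨ rz≋ i ⟩
          b zero * v zero i + 0#                                        ≈⟨ +-congʳ (*-congˡ (trans (*-congʳ (inverseˡ a#0)) (*-identityˡ _))) ⟨
          b zero * (inverse (a zero) * a zero * v zero i) + 0#          ≈⟨ +-congʳ (trans (*-congˡ (*-assoc _ _ _)) (sym (*-assoc _ _ _))) ⟩
          b zero * inverse (a zero) * (a zero * v zero i) + 0#          ≈⟨ +-congʳ (*-congˡ (trans (rx≋ i) (+-identityʳ _))) ⟨
          b zero * inverse (a zero) * (r · x) i + 0#                    ∎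
    where open import Relation.Binary.Reasoning.Setoid setoid

  -- An upper bound for the Wong sequence: P contains whatever the algorithm can generate, and L
  -- maps P into the range of h. A mere predicate is enough, as P serves the proof and is never
  -- computed.
  record Barrier {m n k} (A : Vector (Matrix m n) k) (h : Matrix m n) {p} (P : Pred (Space (Fin n)) p) : Set (c L.⊔ ℓ₁ L.⊔ p) where
    field
      subspace    : Subspace P
      kernel⊆     : ∀ {z} → h · z ≋ 𝟎 → P z
      image⊆      : ∀ j {z} → P z → A j · z ∈ Image h
      preimage⊆   : ∀ j {z w} → P z → h · w ≋ A j · z → P w

  module _ {m n l} (h : Matrix m n) (R : Vector (Matrix m n) l) where

    augmented : List (Fin l) → Matrix m n
    augmented []      = h
    augmented (k ∷ q) = augmented q ⊕ R k

    augmented-∷ : ∀ k q x → augmented (k ∷ q) · x ≋ augmented q · x ⊕ R k · x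
    augmented-∷ k q x i = dot-⊕ˡ (λ j → augmented q (i , j)) (λ j → R k (i , j)) x

    augmented-closed : ∀ {p} {P : Pred (Matrix m n) p} → Subspace P → P h → (∀ k → P (R k)) → ∀ q → P (augmented q)
    augmented-closed subspace Ph PR []      = Ph
    augmented-closed subspace Ph PR (k ∷ q) = ⊕-closed subspace (augmented-closed subspace Ph PR q) (PR k)

  module _ {m n l} (h : Matrix m n) (R : Vector (Matrix m n) l) (g : Space (Fin m) → Space (Fin n))
    (g-linear : Linear g) (hgh : ∀ z → h · g (h · z) ≋ h · z) where

    -- The graph whose paths from start to sink give rise to matrices of larger
    -- rank.  Here g is a generalised inverse of h, so that the ranges of
    -- 1 - gh and of hg are the kernel and the image of h.
    record Tables : Set (c L.⊔ ℓ₁) where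
      field
        start sink       : Fin l → Bool
        edge             : Fin l → Fin l → Bool
        start-determines : ∀ k → Determines (λ z → R k · (z ⊖ g (h · z))) (start k)
        sink-determines  : ∀ k → Determines (λ z → R k · z ⊖ h · g (R k · z)) (sink k)
        edge-determines  : ∀ j k → Determines (λ z → R k · g (R j · z)) (edge j k)

    module _ (tables : Tables) where
      open Tables tables

      module _ (R-rank-one : ∀ k → HasRank (R k) 1) {p} {Y : Pred (Space (Fin m)) p} (Y-subspace : Subspace Y) where

        R⊆ : ∀ j x → R j · x ∈ Y → ¬ R j · x ≋ 𝟎 → ∀ z → R j · z ∈ Y
        R⊆ j x Rx∈ Rx≉𝟎 z = ⟨⟩⊆ Y-subspace (λ _ → Rx∈) (rank-one-multiple {r = R j} (R-rank-one j) x Rx≉𝟎 z)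

        augmented-annihilated : ∀ {s : Fin l → Bool} {q} x → (∀ k → s k ≡ false → R k · x ≋ 𝟎) → All (λ k → s k ≡ false) q →
          augmented h R q · x ≋ h · x
        augmented-annihilated x H []                = λ _ → refl
        augmented-annihilated x H (_∷_ {k} {q} s≡ ¬s) i = trans (augmented-∷ h R k q x i)
          (trans (+-cong (augmented-annihilated x H ¬s i) (H k s≡ i)) (+-identityʳ _))

        -- Along the path, the ranges of the rank one matrices are added to Y one
        -- after the other: as there are no shortcuts, x isolates the first one.
        path⇒strict : ∀ {s : Fin l → Bool} {q} → InducedPath edge sink s q →
          (∀ j → s j ≡ true → ∃[ x ] h · x ∈ Y × ¬ R j · x ≋ 𝟎 × (∀ k → s k ≡ false → R k · x ≋ 𝟎)) →
          (∀ x → augmented h R q · x ∈ Y) →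
          (∀ x → h · x ∈ Y) × (∃[ y ] y ∈ Y × ¬ y ∈ Image h)
        path⇒strict (stop {j = j} sj sink-j) witness ⊆Y =
          let x , hx∈ , Rx≉𝟎 , _ = witness j sj
              Rj∈ = R⊆ j x (≋-closed Y-subspace (⊕-cancel (h · x) (R j · x))
                             (⊖-closed Y-subspace (≋-closed Y-subspace (augmented-∷ h R j [] x) (⊆Y x)) hx∈)) Rx≉𝟎
              z , escapes = proj₁ (sink-determines j) sink-j
          in (λ x → ≋-closed Y-subspace (λ i → trans (+-congʳ (augmented-∷ h R j [] x i))
                       (trans (+-assoc _ _ _) (trans (+-congˡ (-‿inverseʳ _)) (+-identityʳ _))))
                     (⊖-closed Y-subspace (⊆Y x) (Rj∈ x))) ,
             R j · z , Rj∈ z , λ { (w , Rz≋) → escapes (≋⇒⊖≋𝟎 λ i → trans (Rz≋ i) (trans (sym (hgh w i))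
               (≋-cong (∘-linear (·-linear h) g-linear) (λ i → sym (Rz≋ i)) i))) }
        path⇒strict (move {j = j} {q} sj ¬sink-j ¬s p) witness ⊆Y =
          let x , hx∈ , Rx≉𝟎 , vanish = witness j sj
              Rj∈ = R⊆ j x (≋-closed Y-subspace (λ i → trans (+-congʳ (augmented-∷ h R j q x i)) (⊕-cancel (augmented h R q · x) (R j · x) i))
                             (⊖-closed Y-subspace (⊆Y x)
                               (≋-closed Y-subspace (λ i → sym (augmented-annihilated x vanish ¬s i)) hx∈))) Rx≉𝟎
          in path⇒strict p
               -- The witness for a successor of j is g (R j z). As j is not a sink, h maps it back
               -- to R j z, which lies in Y by now; vertices that are no successors of j annihilate
               -- it.
               (λ k jk → let z , Rz≉𝟎 = proj₁ (edge-determines j k) jk in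
                 g (R j · z) , ≋-closed Y-subspace (⊖≋𝟎⇒≋ (proj₂ (sink-determines j) ¬sink-j z)) (Rj∈ z) ,
                 Rz≉𝟎 , λ k′ ¬jk′ → proj₂ (edge-determines j k′) ¬jk′ z)
               (λ x → ≋-closed Y-subspace (λ i → trans (+-congʳ (augmented-∷ h R j q x i))
                        (trans (+-assoc _ _ _) (trans (+-congˡ (-‿inverseʳ _)) (+-identityʳ _))))
                      (⊖-closed Y-subspace (⊆Y x) (Rj∈ x)))

      -- Y is the range of the augmented matrix. The induction starts with vectors z - g (h z) in
      -- the kernel of h, whose image 0 is certainly in Y.
      path⇒rk< : (∀ k → HasRank (R k) 1) → ∀ {q} → InducedPath edge sink start q → h rk< augmented h R q
      path⇒rk< R-rank-one {q} p =
        let h⊆ , y , y∈ , y∉ = path⇒strict R-rank-one (Image-subspace (augmented h R q)) p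
              (λ j sj → let z , Rz≉𝟎 = proj₁ (start-determines j) sj in
                z ⊖ g (h · z) ,
                ≋-closed (Image-subspace (augmented h R q)) (λ i → sym (trans (⊖-homo (·-linear h) z _ i) (≋⇒⊖≋𝟎 (λ i → sym (hgh z i)) i)))
                  (𝟎-closed (Image-subspace (augmented h R q))) ,
                Rz≉𝟎 , λ k ¬sk → proj₂ (start-determines k) ¬sk z)
              (λ x → x , λ _ → refl)
        in strict-image⇒rk< (λ { (x , y≋) → ≋-closed (Image-subspace (augmented h R q)) (λ i → sym (y≋ i)) (h⊆ x) }) y∈ y∉

      -- Let k be outside S. It is not a start, so R k kills the kernel of h. If h w = A j z, then w
      -- is g (A j z) up to this kernel, and A j z is a combination of h z and the R k′ z: those
      -- with k′ outside S vanish, and from k′ in S there is no edge to k. The range of h is not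
      -- left because S contains no sink.
      separation⇒barrier : ∀ {k} (A : Vector (Matrix m n) k) → (∀ j → A j ∈ ⟨ h V.∷ R ⟩) →
        ∀ {S} → Separates edge sink (allFin l) start S →
        Barrier A h (λ z → ∀ k → S k ≡ false → R k · z ≋ 𝟎)
      separation⇒barrier A A∈ {S} (start⊆S , S-closed , S-avoids) = record
        { subspace = record
          { ≋-closed = λ x≋y Px k ¬Sk i → trans (sym (≋-cong (·-linear (R k)) x≋y i)) (Px k ¬Sk i)
          ; 𝟎-closed = λ k _ → 𝟎-homo (·-linear (R k)) λ _ → refl
          ; ⊕-closed = λ Px Py k ¬Sk i → trans (⊕-homo (·-linear (R k)) _ _ i) (trans (+-cong (Px k ¬Sk i) (Py k ¬Sk i)) (+-identityʳ _))
          ; ⊙-closed = λ a Px k ¬Sk i → trans (⊙-homo (·-linear (R k)) a _ i) (x*0≈0 (Px k ¬Sk i))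
          }
        ; kernel⊆ = λ {z} hz≋𝟎 k ¬Sk i → trans
            (≋-cong (·-linear (R k)) (λ a → sym (x-0≈x (𝟎-homo g-linear hz≋𝟎 a))) i)
            (¬start k ¬Sk z i)
        ; image⊆ = λ j {z} Pz → ≋-closed (Image-subspace h) (λ i → sym (A-· j z i))
            (lincomb-closed (Image-subspace h) (proj₁ (A∈ j)) (λ i → (h V.∷ R) i · z)
              λ { zero → z , λ _ → refl ; (suc k) → R∈Image k Pz })
        ; preimage⊆ = λ j {z} {w} Pz hw≋ k ¬Sk i → begin
            (R k · w) i
              ≈⟨ ≋-cong (·-linear (R k)) (⊖-cancel w (g (h · w))) i ⟨
            (R k · ((w ⊖ g (h · w)) ⊕ g (h · w))) i
              ≈⟨ ⊕-homo (·-linear (R k)) (w ⊖ g (h · w)) _ i ⟩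
            (R k · (w ⊖ g (h · w))) i + (R k · g (h · w)) i
              ≈⟨ +-cong (¬start k ¬Sk w i) (≋-cong (Rg-linear k) (λ i → trans (hw≋ i) (A-· j z i)) i) ⟩
            0# + (R k · g (lincomb (proj₁ (A∈ j)) (λ i → (h V.∷ R) i · z))) i
              ≈⟨ +-identityˡ _ ⟩
            (R k · g (lincomb (proj₁ (A∈ j)) (λ i → (h V.∷ R) i · z))) i
              ≈⟨ lincomb-homo (Rg-linear k) (proj₁ (A∈ j)) (λ i → (h V.∷ R) i · z) i ⟩
            lincomb (proj₁ (A∈ j)) (λ i → R k · g ((h V.∷ R) i · z)) i
              ≈⟨ dot-𝟎 (proj₁ (A∈ j)) {λ i′ → (R k · g ((h V.∷ R) i′ · z)) i} (λ { zero → Rgh≋𝟎 k ¬Sk Pz i ; (suc k′) → RgR≋𝟎 k k′ ¬Sk Pz i }) ⟩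
            0# ∎
        }
        where
        open import Relation.Binary.Reasoning.Setoid setoid
        A-· : ∀ j z → A j · z ≋ lincomb (proj₁ (A∈ j)) (λ i → (h V.∷ R) i · z)
        A-· j z i = trans (dot-cong {y = z} (λ q → proj₂ (A∈ j) (i , q)) λ _ → refl) (lincomb-· (proj₁ (A∈ j)) (h V.∷ R) z i)
        Rg-linear : ∀ k → Linear (λ y → R k · g y)
        Rg-linear k = ∘-linear (·-linear (R k)) g-linear
        ¬true⇒false : ∀ {b} → ¬ b ≡ true → b ≡ false
        ¬true⇒false {false} _      = ≡-refl
        ¬true⇒false {true}  b≢true = contradiction ≡-refl b≢true
        false≢true : ∀ {b} → b ≡ false → ¬ b ≡ true
        false≢true ≡-refl ()
        ¬start : ∀ k → S k ≡ false → ∀ z → R k · (z ⊖ g (h · z)) ≋ 𝟎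
        ¬start k ¬Sk = proj₂ (start-determines k) (¬true⇒false λ sk → false≢true ¬Sk (start⊆S (∈-allFin k) sk))
        R∈Image : ∀ k {z} → (∀ k → S k ≡ false → R k · z ≋ 𝟎) → R k · z ∈ Image h
        R∈Image k {z} Pz with S k in Sk
        ... | true  = g (R k · z) , ⊖≋𝟎⇒≋ (proj₂ (sink-determines k) (S-avoids Sk) z)
        ... | false = ≋-closed (Image-subspace h) (λ i → sym (Pz k Sk i)) (𝟎-closed (Image-subspace h))
        Rgh≋𝟎 : ∀ k → S k ≡ false → ∀ {z} → (∀ k → S k ≡ false → R k · z ≋ 𝟎) → R k · g (h · z) ≋ 𝟎
        Rgh≋𝟎 k ¬Sk {z} Pz i = trans (sym (⊖≋𝟎⇒≋ (λ i → trans (sym (⊖-homo (·-linear (R k)) z _ i)) (¬start k ¬Sk z i)) i)) (Pz k ¬Sk i)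
        RgR≋𝟎 : ∀ k k′ → S k ≡ false → ∀ {z} → (∀ k → S k ≡ false → R k · z ≋ 𝟎) → R k · g (R k′ · z) ≋ 𝟎
        RgR≋𝟎 k k′ ¬Sk {z} Pz with S k′ in Sk′
        ... | true  = proj₂ (edge-determines k′ k) (¬true⇒false λ k′k → false≢true ¬Sk (S-closed (∈-allFin k) Sk′ k′k)) z
        ... | false = 𝟎-homo (Rg-linear k) (Pz k′ Sk′)

-- Correctness of the two algorithms.

module Correctness {c ℓ₁ ℓ₂} (F : DiscreteField c ℓ₁ ℓ₂) where
  open import Data.List.Base using ([]; _∷_)
  open Augmentation F public

  ensures-elimination : ∀ {C k m n q} (Q : ⟦ C ⟧ Carrier → Set q) {done : ∀ d → Machine C (System (Input k m n) n m d)}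
    (ρ : Space (Input k m n)) → let h = λ ij → ρ (zero , ij) in
    (∀ d (s : Space (System (Input k m n) n m d)) → s ∘ inj₁ ≡ ρ →
      (∀ z → h · residual h (vectors s) (functionals s) z ≋ 𝟎) → Ensures Q (done d) s) →
    Ensures Q (Elimination.gauss done) ρ
  ensures-elimination Q {done} ρ H = ensures-gauss hᴱ (λ _ → fin _) (λ _ → δᴱ) done ρ (λ _ → refl)
    (λ _ _ → ⊤) (λ _ _ _ _ _ _ _ _ _ → tt) Q (λ _ → tt)
    λ d s s≡ _ _ residuals≋𝟎 → H d s s≡ (residuals-of-units _ (vectors s) (functionals s) s residuals≋𝟎)

  linear∈ : ∀ {n p} {J : Set} {P : Pred (Space J) p} {f : Space (Fin n) → Space J} → Subspace P → Linear f →
    (∀ c → P (f (δ c))) → ∀ z → P (f z)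
  linear∈ {f = f} P-subspace lf Pδ z = ≋-closed P-subspace
    (λ i → sym (trans (≋-cong lf (lincomb-δ z) i) (lincomb-homo lf z δ i)))
    (lincomb-closed P-subspace z (f ∘ δ) Pδ)

  residual≋𝟎⇒hgh : ∀ {m n d} (h : Matrix m n) (x : Vector (Space (Fin n)) d) φ →
    (∀ z → h · residual h x φ z ≋ 𝟎) → ∀ z → h · pull x φ (h · z) ≋ h · z
  residual≋𝟎⇒hgh h x φ ≋𝟎 z i = sym (⊖≋𝟎⇒≋ {x = h · z} (λ i → trans (sym (⊖-homo (·-linear h) z _ i)) (≋𝟎 z i)) i)

  module _ {k m n d₁} (A : Vector (Matrix m n) k) (h : Matrix m n) (h∈ : h ∈ ⟨ A ⟩)
    (s₁ : Space (System (Input k m n) n m d₁)) (s₁≡ : s₁ ∘ inj₁ ≡ uncurry (h V.∷ A))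
    (residual≋𝟎 : ∀ z → h · residual h (vectors s₁) (functionals s₁) z ≋ 𝟎) where

    private
      κ : Space (Fin n) → Space (Fin n)
      κ = residual h (vectors s₁) (functionals s₁)
      g : Space (Fin m) → Space (Fin n)
      g = pull (vectors s₁) (functionals s₁)

    module _ {d : ℕ} (s : Space (System (System (Input k m n) n m d₁) n n d)) (s≡ : s ∘ inj₁ ≡ s₁) where

      eval-input : ∀ i ij → s (inj₁ (inj₁ (i , ij))) ≈ (h V.∷ A) i ij
      eval-input i ij = reflexive (≡-trans (cong (λ f → f (inj₁ (i , ij))) s≡) (cong (λ f → f (i , ij)) s₁≡))

      eval-product : ∀ j i → eval s ∘ Wong.product j i ≋ A j · vectors s i
      eval-product j i = eval-· s (Wong.A j) (vectorᴱ i) (eval-input (suc j)) λ _ → refl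

      eval-g : ∀ y {y′} → eval s ∘ y ≋ y′ → eval s ∘ pullᴱ Wong.x Wong.φ y ≋ g y′
      eval-g y {y′} y≋ a = trans (eval-pull s Wong.x Wong.φ y y≋ a)
        (reflexive (cong (λ (s₁ : Space (System (Input k m n) n m d₁)) → pull (vectors s₁) (functionals s₁) y′ a) s≡))

      eval-kernel : ∀ c → eval s ∘ Wong.candidate d (inj₁ c) ≋ κ (δ c)
      eval-kernel c a = trans (eval-residual s Wong.x Wong.φ Wong.h (eval-input zero) (δᴱ c) (eval-δ s c) a)
        (reflexive (cong (λ (s₁ : Space (System (Input k m n) n m d₁)) → residual h (vectors s₁) (functionals s₁) (δ c) a) s≡))

      eval-preimage : ∀ j i → eval s ∘ Wong.candidate d (inj₂ (j , i)) ≋ g (A j · vectors s i)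
      eval-preimage j i = eval-g (Wong.product j i) (eval-product j i)

      eval-escape : ∀ j i p → eval s (Wong.escape d (j , i , p)) ≈ (A j · vectors s i ⊖ h · g (A j · vectors s i)) p
      eval-escape j i p = +-cong (eval-product j i p) (-‿cong
        (eval-· s Wong.h (pullᴱ Wong.x Wong.φ (Wong.product j i)) (eval-input zero) (eval-preimage j i) p))

    -- P is any subspace that contains all candidates. It is instantiated twice: by the whole space,
    -- where `nothing` is justified by other means, and by a barrier, where an escape is impossible.
    ensures-wong : ∀ {p q} {P : Pred (Space (Fin n)) p} → Subspace P → (∀ z → P (κ z)) → (∀ j {z} → P z → P (g (A j · z))) →
      (Q : ⟦ WitnessOutput n ⟧ Carrier → Set q) →
      (∀ j {z} → P z → ¬ A j · z ⊖ h · g (A j · z) ≋ 𝟎 → ∀ out → Q (nothing , out)) →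
      (∀ d (x : Vector (Space (Fin n)) d) → MaximumRank ⟨ A ⟩ h × LinearlyIndependent x × RankFormula ⟨ A ⟩ h ⟨ x ⟩ →
        Q (just d , uncurry x)) →
      Ensures Q (Wong.gauss {k} {n} {m} {d₁}) s₁
    ensures-wong {P = P} P-subspace Pκ Pg Q escaped finished =
      ensures-gauss Wong.𝐈ᴱ (λ d → fin n ⊎ᶠ (fin k ×ᶠ fin d)) Wong.candidate Wong.answer s₁ {𝐈} (λ { (i , j) → eval-δ s₁ i j })
        (λ d x → ∀ i → P (x i))
        (λ { s s≡ c x φ biorth x≡ x₀≋ Px → λ where
          zero    → ≋-closed P-subspace (λ a → sym (x₀≋ a))
                      (⊖-closed P-subspace (P-candidate s s≡ Px c) (lincomb-closed P-subspace _ _ Px))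
          (suc i) → subst (λ x → P (x i)) (≡-sym x≡) (Px i) })
        Q (λ _ ())
        λ d s s≡ biorth Px residuals≋𝟎 → ensures-search Q (fin k ×ᶠ (fin d ×ᶠ fin m)) {Wong.escape d}
          (λ { (j , i , p) escape#0 → halt (escaped j (Px i)
            (λ escape≋𝟎 → nonzero⇒≉ escape#0 (trans (eval-escape s s≡ j i p) (escape≋𝟎 p))) _) })
          (λ escapes≈0 → halt (finished d (vectors s) (stable s s≡ biorth residuals≋𝟎 escapes≈0)))
      where
      P-candidate : ∀ {d} s → s ∘ inj₁ ≡ s₁ → (∀ i → P (vectors s i)) → ∀ c → P (eval s ∘ Wong.candidate d c)
      P-candidate s s≡ Px (inj₁ c)       = ≋-closed P-subspace (λ a → sym (eval-kernel s s≡ c a)) (Pκ (δ c))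
      P-candidate s s≡ Px (inj₂ (j , i)) = ≋-closed P-subspace (λ a → sym (eval-preimage s s≡ j i a)) (Pg j (Px i))

      stable : ∀ {d} s → s ∘ inj₁ ≡ s₁ → Biorthogonal 𝐈 (vectors s) (functionals s) →
        (∀ c → 𝐈 · residual 𝐈 (vectors s) (functionals s) (eval s ∘ Wong.candidate d c) ≋ 𝟎) →
        (∀ jip → eval s (Wong.escape d jip) ≈ 0#) →
        MaximumRank ⟨ A ⟩ h × LinearlyIndependent (vectors s) × RankFormula ⟨ A ⟩ h ⟨ vectors s ⟩
      stable {d} s s≡ biorth residuals≋𝟎 escapes≈0 =
        Closed.maximal A h h∈ (vectors s) (functionals s) biorth
          -- On the kernel of h the map `κ` is the identity, so z is a combination of the candidates
          -- `κ (δ c)`, all of which are in the span by now.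
          (λ z hz≋𝟎 → ≋-closed (⟨⟩-subspace (vectors s))
            (λ a → x-0≈x (𝟎-homo (pull-linear (vectors s₁) (functionals s₁)) hz≋𝟎 a))
            (linear∈ (⟨⟩-subspace (vectors s)) (residual-linear h (vectors s₁) (functionals s₁))
              (λ c → ≋-closed (⟨⟩-subspace (vectors s)) (eval-kernel s s≡ c) (candidate∈ (inj₁ c))) z))
          λ j i → let a , g≋ = ≋-closed (⟨⟩-subspace (vectors s)) (eval-preimage s s≡ j i) (candidate∈ (inj₂ (j , i))) in
            a , λ p → begin
              (A j · vectors s i) p                       ≈⟨ ⊖≋𝟎⇒≋ (λ p → trans (sym (eval-escape s s≡ j i p)) (escapes≈0 (j , i , p))) p ⟩
              (h · g (A j · vectors s i)) p               ≈⟨ ≋-cong (·-linear h) g≋ p ⟩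
              (h · lincomb a (vectors s)) p               ≈⟨ lincomb-homo (·-linear h) a (vectors s) p ⟩
              lincomb a (λ i → h · vectors s i) p         ∎
        where
        open import Relation.Binary.Reasoning.Setoid setoid
        candidate∈ : ∀ c → eval s ∘ Wong.candidate d c ∈ ⟨ vectors s ⟩
        candidate∈ c = ≋-closed (⟨⟩-subspace (vectors s))
          (λ a → sym (trans (sym (𝐈·≋ _ a)) (trans
            (T-residual≋𝟎⇒ 𝐈 (vectors s) (functionals s) biorth (eval s ∘ Wong.candidate d c) (residuals≋𝟎 c) a) (𝐈·≋ _ a))))
          (pull∈⟨⟩ (vectors s) (functionals s) _)

    -- For z in P, the vector A j z lies in the range of h and so is fixed by hg. Hence g (A j z) is
    -- a preimage of it, thus in P, and A j z cannot escape.
    ensures-barrier : ∀ {p q} {P : Pred (Space (Fin n)) p} → Barrier A h P → (Q : ⟦ WitnessOutput n ⟧ Carrier → Set q) →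
      (∀ d (x : Vector (Space (Fin n)) d) → MaximumRank ⟨ A ⟩ h × LinearlyIndependent x × RankFormula ⟨ A ⟩ h ⟨ x ⟩ →
        Q (just d , uncurry x)) →
      Ensures Q (Wong.gauss {k} {n} {m} {d₁}) s₁
    ensures-barrier barrier Q finished = ensures-wong subspace (λ z → kernel⊆ (residual≋𝟎 z))
      (λ j Pz → preimage⊆ j Pz (hgA j Pz)) Q
      (λ j Pz escapes → contradiction (≋⇒⊖≋𝟎 (λ i → sym (hgA j Pz i))) escapes)
      finished
      where
      open Barrier barrier
      hgA : ∀ j {z} → _ → h · g (A j · z) ≋ A j · z
      hgA j Pz = let w , Az≋ = image⊆ j Pz in λ i →
        trans (≋-cong (∘-linear (·-linear h) (pull-linear (vectors s₁) (functionals s₁))) Az≋ i) (trans (residual≋𝟎⇒hgh h (vectors s₁) (functionals s₁) residual≋𝟎 w i) (sym (Az≋ i)))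

  -- The counterpart of `survey` inside the proof. It provides the graph for the analysis of the
  -- first algorithm, whose program has no access to the R j.
  detect : ∀ {n m} (v : Space (Fin n × Fin m)) → ∃[ b ] Detects v b
  detect {n} {m} v with zero⊎nonzeroEntry (v ∘ Inverse.to (fin n ×ᶠ fin m))
  ... | inj₂ (q , v#0) = true , L.lift (_ , v#0)
  ... | inj₁ v≋𝟎       = false , L.lift λ ci →
    subst (λ ci → v ci ≈ 0#) (Inverse.strictlyInverseˡ (fin n ×ᶠ fin m) ci) (v≋𝟎 (Inverse.from (fin n ×ᶠ fin m) ci))

  detects⇒determines : ∀ {n m} {f : Space (Fin n) → Space (Fin m)} → Linear f → {v : Space (Fin n × Fin m)} →
    (∀ c i → v (c , i) ≈ f (δ c) i) → ∀ {b} → Detects v b → Determines f b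
  detects⇒determines lf v≈ {true} (L.lift ((c , i) , v#0)) =
    (λ _ → δ c , λ f≋𝟎 → nonzero⇒≉ v#0 (trans (v≈ c i) (f≋𝟎 i))) , λ ()
  detects⇒determines lf v≈ {false} (L.lift v≋𝟎) =
    (λ ()) , λ _ → linear≋𝟎 lf λ c i → trans (sym (v≈ c i)) (v≋𝟎 (c , i))

  module _ {m n l} (h : Matrix m n) (R : Vector (Matrix m n) l) {g : Space (Fin m) → Space (Fin n)} (lg : Linear g) where

    start-linear : ∀ k → Linear (λ z → R k · (z ⊖ g (h · z)))
    start-linear k = ∘-linear (·-linear (R k)) (id-⊖-linear (∘-linear lg (·-linear h)))

    sink-linear : ∀ k → Linear (λ z → R k · z ⊖ h · g (R k · z))
    sink-linear k = ∘-linear (id-⊖-linear (∘-linear (·-linear h) lg)) (·-linear (R k))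

    edge-linear : ∀ j k → Linear (λ z → R k · g (R j · z))
    edge-linear j k = ∘-linear (·-linear (R k)) (∘-linear lg (·-linear (R j)))

    tables : (hgh : ∀ z → h · g (h · z) ≋ h · z) → Tables h R g lg hgh
    tables hgh = record
      { start            = λ k → proj₁ (start k)
      ; sink             = λ k → proj₁ (sink k)
      ; edge             = λ j k → proj₁ (edge j k)
      ; start-determines = λ k → detects⇒determines (start-linear k) (λ _ _ → refl) (proj₂ (start k))
      ; sink-determines  = λ k → detects⇒determines (sink-linear k) (λ _ _ → refl) (proj₂ (sink k))
      ; edge-determines  = λ j k → detects⇒determines (edge-linear j k) (λ _ _ → refl) (proj₂ (edge j k))
      }
      where
      start = λ k → detect (uncurry λ c → R k · (δ c ⊖ g (h · δ c)))
      sink  = λ k → detect (uncurry λ c → R k · δ c ⊖ h · g (R k · δ c))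
      edge  = λ j k → detect (uncurry λ c → R k · g (R j · δ c))

  module _ {k m n l} (A : Vector (Matrix m n) k) (h : Matrix m n) (h∈ : h ∈ ⟨ A ⟩) (R : Vector (Matrix m n) l)
    (spanned : SpannedWithRankOnes ⟨ A ⟩ h R) where

    A∈ : ∀ j → A j ∈ ⟨ h V.∷ R ⟩
    A∈ j = proj₁ (proj₂ spanned) (∈⟨⟩ A j)

    R∈ : ∀ j → R j ∈ ⟨ A ⟩
    R∈ j = proj₂ (proj₂ spanned) (∈⟨⟩ (h V.∷ R) (suc j))

    augmented∈ : ∀ q → augmented h R q ∈ ⟨ A ⟩
    augmented∈ = augmented-closed h R (⟨⟩-subspace A) h∈ R∈

    -- A path yields an element of L of larger rank, which justifies `nothing`; a separating set
    -- yields a barrier, which excludes it. In both cases `just` is certified by `Closed.maximal`.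
    alg₁-correct : CorrectWitness ⟨ A ⟩ h (run (alg₁ n m k) (uncurry (h V.∷ A)))
    alg₁-correct = run-compile (CorrectWitness ⟨ A ⟩ h) id _ (ensures-elimination (CorrectWitness ⟨ A ⟩ h) (uncurry (h V.∷ A)) after)
      where
      after : ∀ d (s : Space (System (Input k m n) n m d)) → s ∘ inj₁ ≡ uncurry (h V.∷ A) →
        (∀ z → h · residual h (vectors s) (functionals s) z ≋ 𝟎) → Ensures (CorrectWitness ⟨ A ⟩ h) Wong.gauss s
      after d s s≡ residual≋𝟎 =
        [ (λ { (q , _ , path) → ensures-wong A h h∈ s s≡ residual≋𝟎 everything (λ _ → tt) (λ _ _ → tt) _
               (λ _ _ _ _ → rk<⇒¬maximal (augmented∈ q) (path⇒rk< h R g lg hgh t (proj₁ spanned) path))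
               (λ _ _ → id) })
        , (λ { (S , separates) → ensures-barrier A h h∈ s s≡ residual≋𝟎
               (separation⇒barrier h R g lg hgh t A A∈ separates) _ (λ _ _ → id) })
        ] (path⊎separation edge sink l (allFin l) (ℕₚ.≤-reflexive (length-tabulate id)) start)
        where
        g = pull (vectors s) (functionals s)
        lg = pull-linear (vectors s) (functionals s)
        hgh = residual≋𝟎⇒hgh h (vectors s) (functionals s) residual≋𝟎
        t = tables h R lg hgh
        open Tables t
        everything : Subspace (λ (_ : Space (Fin n)) → ⊤)
        everything = record
          { ≋-closed = λ _ _ → tt ; 𝟎-closed = tt ; ⊕-closed = λ _ _ → tt ; ⊙-closed = λ _ _ → tt }

    -- The Wong machine as a proof device: its run on a state made from x and φ meets no escape,
    -- hence ends with a certificate of maximality.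
    barrier⇒maximal : ∀ {d} (x : Vector (Space (Fin n)) d) (φ : Vector (Space (Fin m)) d) →
      (∀ z → h · residual h x φ z ≋ 𝟎) → ∀ {p} {P : Pred (Space (Fin n)) p} → Barrier A h P → MaximumRank ⟨ A ⟩ h
    barrier⇒maximal {d} x φ residual≋𝟎 barrier = run-compile (λ _ → MaximumRank ⟨ A ⟩ h) id s
      (ensures-barrier A h h∈ s ≡-refl residual≋𝟎 barrier (λ _ → MaximumRank ⟨ A ⟩ h) (λ _ _ → proj₁))
      where
      s : Space (System (Input k m n) n m d)
      s (inj₁ b)            = uncurry (h V.∷ A) b
      s (inj₂ (i , inj₁ a)) = x i a
      s (inj₂ (i , inj₂ q)) = φ i q

    HasRank-cong : ∀ {b b′ : Matrix m n} {r} → b ≋ b′ → HasRank b r → HasRank b′ r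
    HasRank-cong {b} {b′} b≋ (v , indep , Image⊆ , ⊆Image) = v , indep ,
      (λ { (x , y≋) → Image⊆ (x , λ i → trans (y≋ i) (sym (b≋· x i))) }) ,
      (λ y∈ → let x , y≋ = ⊆Image y∈ in x , λ i → trans (y≋ i) (b≋· x i))
      where
      b≋· : ∀ x → b · x ≋ b′ · x
      b≋· x i = dot-cong {y = x} (λ j → b≋ (i , j)) λ _ → refl

    -- The surveyed tables describe the graph faithfully since linear maps are determined by the
    -- unit vectors. A separating set would make h maximal, so the search has found a path.
    alg₂-correct : ¬ MaximumRank ⟨ A ⟩ h →
      let h′ = proj₂ (run (alg₂ n m k l) (uncurry (h V.∷ (A V.++ R)))) in h′ ∈ ⟨ A ⟩ × h rk< h′
    alg₂-correct ¬maximal = run-compile Q id _ (ensures-elimination Q (uncurry (h V.∷ (A V.++ R))) after)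
      where
      Q : ⟦ MatrixOutput m n ⟧ Carrier → Set (c L.⊔ ℓ₁)
      Q out = proj₂ out ∈ ⟨ A ⟩ × h rk< proj₂ out
      after : ∀ d (s : Space (System (Input (k ℕ.+ l) m n) n m d)) → s ∘ inj₁ ≡ uncurry (h V.∷ (A V.++ R)) →
        (∀ z → h · residual h (vectors s) (functionals s) z ≋ 𝟎) → Ensures Q (Augment.answer {k}) s
      after d s s≡ residual≋𝟎 =
        ensures-survey Q (fin l) (fin n ×ᶠ fin m) {startᴱ} λ start start-detects →
        ensures-survey Q (fin l) (fin n ×ᶠ fin m) {sinkᴱ} λ sink sink-detects →
        ensures-survey Q (fin l ×ᶠ fin l) (fin n ×ᶠ fin m) {edgeᴱ} λ edge edge-detects →
        let t : Tables h R g lg hgh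
            t = record
              { start            = start
              ; sink             = sink
              ; edge             = λ j k → edge (j , k)
              ; start-determines = λ k → detects⇒determines (start-linear h R lg k) (eval-start k) (start-detects k)
              ; sink-determines  = λ k → detects⇒determines (sink-linear h R lg k) (eval-sink k) (sink-detects k)
              ; edge-determines  = λ j k → detects⇒determines (edge-linear h R lg j k) (eval-edge j k) (edge-detects (j , k))
              }
        in ensures-output t (paths start sink edge)
        where
        open Augment {k} {l} {n} {m} {d} renaming (h to h↑; R to R↑)
        g = pull (vectors s) (functionals s)
        lg = pull-linear (vectors s) (functionals s)
        hgh = residual≋𝟎⇒hgh h (vectors s) (functionals s) residual≋𝟎
        eval-h : eval s ∘ h↑ ≋ h
        eval-h ij = reflexive (cong (λ f → f (zero , ij)) s≡)
        eval-R : ∀ j → eval s ∘ R↑ j ≋ R j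
        -- Behind h and the k matrices of the basis, `A ++ R` continues with R, whence the shift by
        -- k.
        eval-R j ij = reflexive (≡-trans (cong (λ f → f (suc (k ↑ʳ j) , ij)) s≡)
          (cong (λ (i : Fin k ⊎ Fin l) → [_,_] {C = λ _ → Matrix m n} A R i ij) (splitAt-↑ʳ k l j)))
        eval-gR : ∀ j c → eval s ∘ pullᴱ vectorᴱ functionalᴱ (R↑ j ·ᴱ δᴱ c) ≋ g (R j · δ c)
        eval-gR j c = eval-pull s vectorᴱ functionalᴱ (R↑ j ·ᴱ δᴱ c) (eval-· s (R↑ j) (δᴱ c) (eval-R j) (eval-δ s c))
        eval-start : ∀ j c i → eval s (startᴱ j (c , i)) ≈ (R j · (δ c ⊖ g (h · δ c))) i
        eval-start j c = eval-· s (R↑ j) (residualᴱ h↑ vectorᴱ functionalᴱ (δᴱ c)) (eval-R j)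
          (eval-residual s vectorᴱ functionalᴱ h↑ eval-h (δᴱ c) (eval-δ s c))
        eval-sink : ∀ j c i → eval s (sinkᴱ j (c , i)) ≈ (R j · δ c ⊖ h · g (R j · δ c)) i
        eval-sink j c i = +-cong (eval-· s (R↑ j) (δᴱ c) (eval-R j) (eval-δ s c) i) (-‿cong
          (eval-· s h↑ (pullᴱ vectorᴱ functionalᴱ (R↑ j ·ᴱ δᴱ c)) eval-h (eval-gR j c) i))
        eval-edge : ∀ j j′ c i → eval s (edgeᴱ (j , j′) (c , i)) ≈ (R j′ · g (R j · δ c)) i
        eval-edge j j′ c = eval-· s (R↑ j′) (pullᴱ vectorᴱ functionalᴱ (R↑ j ·ᴱ δᴱ c)) (eval-R j′) (eval-gR j c)
        eval-augmented : ∀ q → eval s ∘ augmentedᴱ q ≋ augmented h R q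
        eval-augmented []      ij = eval-h ij
        eval-augmented (j ∷ q) ij = +-cong (eval-augmented q ij) (eval-R j ij)
        ensures-output : (t : Tables h R g lg hgh) → let open Tables t in
          (p : (∃[ q ] length q ℕ.≤ suc l × InducedPath edge sink start q) ⊎ (∃[ S ] Separates edge sink (allFin l) start S)) →
          Ensures Q (output ([ proj₁ , (λ _ → []) ] p)) s
        ensures-output t (inj₂ (S , separates)) = contradiction
          (barrier⇒maximal (vectors s) (functionals s) residual≋𝟎 (separation⇒barrier h R g lg hgh t A A∈ separates)) ¬maximal
        ensures-output t (inj₁ (q , _ , path)) = step {e = augmentedᴱ q} λ s′ _ s′≡ →
          let augmented≋ : augmented h R q ≋ s′ ∘ inj₂
              augmented≋ ij = trans (sym (eval-augmented q ij)) (reflexive (≡-sym (s′≡ ij)))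
              r , r′ , h-rank , q-rank , r<r′ = path⇒rk< h R g lg hgh t (proj₁ spanned) path
          in halt (≋-closed (⟨⟩-subspace A) augmented≋ (augmented∈ q) ,
                   r , r′ , h-rank , HasRank-cong augmented≋ q-rank , r<r′)

open import Data.Nat.Base using (_≤_; _+_; _*_; _^_)
open import Data.Vec.Functional using (_∷_; _++_)

theorem2p4 : ∀ {c ℓ₁ ℓ₂} →
    (Σ[ alg ∈ (∀ n m k → Program (WitnessOutput n) (Fin (suc k) × Fin m × Fin n)) ]
    (∃[ a ] ∃[ e ] (∀ n m k → time (alg n m k) ≤ a * suc (n + m + k) ^ e))
    × (∀ (F : DiscreteField c ℓ₁ ℓ₂) → let open Over F in
    ∀ n m k (A : Vector (Matrix m n) k) (h : Matrix m n) →
    LinearlyIndependent A →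
    h ∈ ⟨ A ⟩ →
    (∃[ l ] Σ[ R ∈ Vector (Matrix m n) l ] SpannedWithRankOnes ⟨ A ⟩ h R) →
    CorrectWitness ⟨ A ⟩ h (run (alg n m k) (uncurry (h ∷ A)))))
    ×
    (Σ[ alg ∈ (∀ n m k l → Program (MatrixOutput m n) (Fin (suc (k + l)) × Fin m × Fin n)) ]
    (∃[ a ] ∃[ e ] (∀ n m k l → time (alg n m k l) ≤ a * suc (n + m + k + l) ^ e))
    × (∀ (F : DiscreteField c ℓ₁ ℓ₂) → let open Over F in
    ∀ n m k l (A : Vector (Matrix m n) k) (h : Matrix m n) (R : Vector (Matrix m n) l) →
    LinearlyIndependent A →
    h ∈ ⟨ A ⟩ →
    SpannedWithRankOnes ⟨ A ⟩ h R →
    ¬ MaximumRank ⟨ A ⟩ h →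
    let h′ = proj₂ (run (alg n m k l) (uncurry (h ∷ (A ++ R)))) in
    h′ ∈ ⟨ A ⟩ × h rk< h′))
theorem2p4 =
  (alg₁ , (3 ^ 36 , 36 , time-alg₁) , λ F n m k A h _ h∈ (l , R , spanned) →
    Correctness.alg₁-correct F A h h∈ R spanned) ,
  (alg₂ , (3 ^ 23 , 23 , time-alg₂) , λ F n m k l A h R _ h∈ spanned ¬maximal →
    Correctness.alg₂-correct F A h h∈ R spanned ¬maximal)
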